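{- Let $h\geq 4$ and $k\geq 3h+3$ be positive integers. Let $A$ be a finite set of $k$ integers such that $\min(A)=0$, $\gcd(A)=1$, and $|h^{\wedge}A| = hk-h^2+3$. Then $A=[0,k+1]\setminus\{x,y\}$, where $\{x,y\}$ is one of the sets $\{1,2\}$, $\{k-1,k\}$, $\{1,k\}$, $\{2,k+1\}$, $\{k-2,k+1\}$.
   Context: For a finite set $A$ of integers and a positive integer $h\le |A|$, the restricted $h$-fold sumset $h^{\wedge}A$ is the set of all sums of $h$ distinct elements of $A$. For integers $\alpha\le\beta$, $[\alpha,\beta]=\{x\in\mathbb{Z}:\alpha\le x\le\beta\}$. $\gcd(A)$ denotes the greatest common divisor of the elements of $A$. -}

module Defs where

open import Data.Nat as ℕ using (ℕ)
open import Data.Nat.GCD using (gcd)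
open import Data.Integer as ℤ using (ℤ; +_; ∣_∣)
open import Data.List using (List; length; map; foldr)
open import Data.List.Membership.Propositional using (_∈_)
open import Data.List.Relation.Unary.Unique.Propositional using (Unique)
open import Data.List.Relation.Binary.Sublist.Propositional using (_⊆_)
open import Data.Product using (Σ; _×_; ∃)
open import Function.Bundles using (_⇔_)
open import Relation.Binary.PropositionalEquality using (_≡_)

-- A finite set of integers is represented by a duplicate-free list.

sumℤ : List ℤ → ℤ
sumℤ = foldr ℤ._+_ (+ 0)

-- Restricted h-fold sumset h^A: s is the sum of h distinct elements of A.
-- Since A is duplicate-free, choosing h distinct elements of A is the same
-- as choosing a sublist of A of length h.
_∈RestrSumset_,_ : ℤ → ℕ → List ℤ → Set
s ∈RestrSumset h , A = Σ (List ℤ) λ B → B ⊆ A × length B ≡ h × sumℤ B ≡ s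

HasCard : (ℤ → Set) → ℕ → Set
HasCard P n = Σ (List ℤ) λ L → Unique L × length L ≡ n × (∀ x → (x ∈ L) ⇔ P x)

gcdList : List ℤ → ℕ
gcdList A = foldr gcd 0 (map ∣_∣ A)

MinIsZero : List ℤ → Set
MinIsZero A = (+ 0 ∈ A) × (∀ a → a ∈ A → + 0 ℤ.≤ a)

{-# OPTIONS --safe #-}
module Submission where

-- Write A = {a₀ < … < a_{k-1}}. Along a maximal chain of h-subsets, each obtained from the previous
-- one by replacing an element by its successor, the sums increase strictly, so |h^A| ≥ hk - h² + 1;
-- here at most two sums lie off such a chain. A chain passing three times through a pair of
-- independent moves of different lengths would leave out three sums. With four moving elements this
-- shows that all gaps of A but the first two and the last two equal a common c, and
-- comparing the sums of {0, a, b, r} and {1, a, b, r} (as index sets) for four consecutive r shows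
-- that the end gaps lie in {c, 2c, 3c}. Hence c = gcd(A) = 1. With end gaps α, β, …, γ, δ the set
-- h^A is then a full interval of hk - h² + 1 + (α - 1) + 2(β - 1) + 2(γ - 1) + (δ - 1) integers,
-- and α + 2β + 2γ + δ = 8 has the five solutions listed.

open import Defs
open import Data.Bool using (Bool; true; false; T; _∧_)
open import Data.Bool.Properties using (T-∧)
open import Data.Empty using (⊥-elim)
open import Data.Integer as ℤ using (ℤ; +_; _-_; _+_; -_; _≤_; _<_; ∣_∣)
import Data.Integer.Divisibility.Signed as ℤDiv
open ℤDiv using () renaming (_∣_ to _ℤ∣_)
import Data.Integer.Properties as ℤₚ
open import Data.Integer.Tactic.RingSolver using (solve-∀)
open import Data.List using (List; []; _∷_; length; map; replicate; reverse; take; _++_; [_])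
open import Data.List.Membership.Propositional using (_∈_)
open import Data.List.Membership.Propositional.Properties using (∈-∃++; ∈-++⁻; ∈-++⁺ˡ; ∈-++⁺ʳ)
import Data.List.Properties as Listₚ
open import Data.List.Relation.Binary.Permutation.Propositional as Perm using (_↭_; ↭-sym; ↭⇒↭ₛ)
import Data.List.Relation.Binary.Permutation.Propositional.Properties as Permₚ
import Data.List.Relation.Binary.Permutation.Setoid.Properties as PermSetoidₚ
open import Data.List.Relation.Binary.Sublist.Propositional using (_⊆_; []; _∷_; _∷ʳ_)
import Data.List.Relation.Binary.Sublist.Propositional.Properties as Subₚ
open import Data.List.Relation.Unary.All as All using (All; []; _∷_)
import Data.List.Relation.Unary.All.Properties as Allₚ
open import Data.List.Relation.Unary.AllPairs as AllPairs using (AllPairs; []; _∷_)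
import Data.List.Relation.Unary.AllPairs.Properties as AllPairsₚ
open import Data.List.Relation.Unary.Any using (here; there)
open import Data.List.Relation.Unary.Linked.Properties using (Linked⇒AllPairs)
open import Data.List.Relation.Unary.Unique.Propositional using (Unique)
import Data.List.Sort
open import Data.Nat as ℕ using (ℕ; zero; suc)
import Data.Nat.Divisibility as ℕDiv
open import Data.Nat.GCD using (gcd-greatest)
import Data.Nat.Properties as ℕₚ
import Data.Nat.Tactic.RingSolver as ℕSolver
open import Data.Product using (Σ; _×_; _,_; proj₁; proj₂)
open import Data.Sum using (_⊎_; inj₁; inj₂)
open import Function.Bundles using (_⇔_; mk⇔; Equivalence)
open import Relation.Binary.Definitions using (tri<; tri≈; tri>)
open import Relation.Binary.PropositionalEquality hiding ([_])
open import Relation.Nullary using (¬_; yes; no)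

open Data.List.Sort ℤₚ.≤-decTotalOrder using (sort; sort-↭; sort-↗)

-- Two facts make the argument local. The excess of the number of sums over `h g + 1` survives when
-- an element is added at either end of the list, be it as a new summand (`h` grows) or as a new
-- non-summand (`g` grows). It is thus enough to exhibit excess 3 in a window of eight or nine
-- consecutive elements with four summands, where each step is a computation on a closed mask. The
-- first two and the last two gaps are special because of how often a maximal chain crosses a gap:
-- 1, 2, 3, ... times counted from the left, and likewise from the right. Three passes through a
-- pair of moves need gaps that are crossed at least three times, so the outer gaps call for the
-- comparison of two arithmetic progressions of sums instead. The same crossing numbers are the
-- weights 1, 2, 2, 1 of the end gaps in the final count, since they tell how often each gap enters
-- the difference between the largest and the smallest sum.

-- Chains of sums, and the excess of a sumset over its minimal cardinality

-- Chain P n s t: n elements of P in increasing order in the half-open interval [s, t).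
data Chain (P : ℤ → Set) : ℕ → ℤ → ℤ → Set where
  stop : ∀ {s t} → s ≤ t → Chain P 0 s t
  step : ∀ {n s x y t} → s ≤ x → P x → x < y → Chain P n y t → Chain P (suc n) s t

module _ {P : ℤ → Set} where

  single : ∀ {x y} → P x → x < y → Chain P 1 x y
  single p x<y = step ℤₚ.≤-refl p x<y (stop ℤₚ.≤-refl)

  Chain-length : ∀ {m n s t} → m ≡ n → Chain P m s t → Chain P n s t
  Chain-length refl c = c

  Chain-lower : ∀ {n s s′ t} → s′ ≤ s → Chain P n s t → Chain P n s′ t
  Chain-lower s′≤s (stop s≤t)         = stop (ℤₚ.≤-trans s′≤s s≤t)
  Chain-lower s′≤s (step s≤x p x<y c) = step (ℤₚ.≤-trans s′≤s s≤x) p x<y c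

  infixr 5 _⟨++⟩_
  _⟨++⟩_ : ∀ {m n s t u} → Chain P m s t → Chain P n t u → Chain P (m ℕ.+ n) s u
  stop s≤t         ⟨++⟩ d = Chain-lower s≤t d
  step s≤x p x<y c ⟨++⟩ d = step s≤x p x<y (c ⟨++⟩ d)

  -- The lower end constrains only the first element. The upper end is existential because an empty
  -- chain may have ended below `b`.
  Chain-raise : ∀ {b} → (∀ {x} → P x → b ≤ x) → ∀ {n s t} → Chain P n s t →
                Σ ℤ (Chain P n b)
  Chain-raise b≤P (stop _)         = _ , stop ℤₚ.≤-refl
  Chain-raise b≤P (step _ p x<y c) = _ , step (b≤P p) p x<y c

  Chain-map : ∀ {Q : ℤ → Set} a → (∀ {x} → P x → Q (a + x)) → ∀ {n s t} →
              Chain P n s t → Chain Q n (a + s) (a + t)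
  Chain-map a f (stop s≤t)         = stop (ℤₚ.+-monoʳ-≤ a s≤t)
  Chain-map a f (step s≤x p x<y c) =
    step (ℤₚ.+-monoʳ-≤ a s≤x) (f p) (ℤₚ.+-monoʳ-< a x<y) (Chain-map a f c)

  Chain-⊆ : ∀ {Q : ℤ → Set} → (∀ {x} → P x → Q x) → ∀ {n s t} →
            Chain P n s t → Chain Q n s t
  Chain-⊆ f (stop s≤t)         = stop s≤t
  Chain-⊆ f (step s≤x p x<y c) = step s≤x (f p) x<y (Chain-⊆ f c)

-- Reflection turns `[s, t)` into an interval open on the left and closed on the right; adding 1 to
-- both ends makes it half-open in the original sense.
Chain-flip : ∀ {P Q : ℤ → Set} K → (∀ {x} → P x → Q (K - x)) → ∀ {n s t} →
             Chain P n s t → Chain Q n (+ 1 + (K - t)) (+ 1 + (K - s))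
Chain-flip K f (stop s≤t) = stop (ℤₚ.+-monoʳ-≤ (+ 1) (ℤₚ.+-monoʳ-≤ K (ℤₚ.neg-mono-≤ s≤t)))
Chain-flip {Q = Q} K f {suc n} (step {x = x} s≤x p x<y c) =
  Chain-length (ℕₚ.+-comm n 1)
    (Chain-flip K f c ⟨++⟩
     step (ℤₚ.i<j⇒suc[i]≤j (ℤₚ.+-monoʳ-< K (ℤₚ.neg-mono-< x<y))) (f p)
          (ℤₚ.<-≤-trans (ℤₚ.suc[i]≤j⇒i<j {i = K - x} ℤₚ.≤-refl)
            (ℤₚ.+-monoʳ-≤ (+ 1) (ℤₚ.+-monoʳ-≤ K (ℤₚ.neg-mono-≤ s≤x))))
          (stop ℤₚ.≤-refl))

Sums : ℕ → List ℤ → ℤ → Set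
Sums h A s = s ∈RestrSumset h , A

Sorted : List ℤ → Set
Sorted = AllPairs _<_

keep : ∀ {h a A s} → Sums h A s → Sums (suc h) (a ∷ A) (a + s)
keep (B , B⊆A , refl , refl) = _ ∷ B , refl ∷ B⊆A , refl , refl

skip : ∀ {h a A s} → Sums h A s → Sums h (a ∷ A) s
skip (B , B⊆A , refl , refl) = B , _ ∷ʳ B⊆A , refl , refl

take-∈Sums : ∀ {h} A → h ℕ.≤ length A → Sums h A (sumℤ (take h A))
take-∈Sums {zero}  []      _   = [] , [] , refl , refl
take-∈Sums {zero}  (a ∷ A) _   = skip (take-∈Sums A ℕ.z≤n)
take-∈Sums {suc h} (a ∷ A) (ℕ.s≤s h≤) = keep (take-∈Sums A h≤)

-- Starting from the h smallest elements of a ∷ B, replace the elements one at a time, from the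
-- largest down, by their successors in a ∷ B.
shift-chain : ∀ {h a} B → Sorted (a ∷ B) → h ℕ.≤ length B →
              Chain (Sums h (a ∷ B)) h (sumℤ (take h (a ∷ B))) (sumℤ (take h B))
shift-chain {zero} B _ _ = stop ℤₚ.≤-refl
shift-chain {suc h} {a} (b ∷ B) ((a<b ∷ _) ∷ sB) (ℕ.s≤s h≤) =
  Chain-length (ℕₚ.+-comm h 1)
    (Chain-map a keep (shift-chain B sB h≤) ⟨++⟩
     single (keep (skip (take-∈Sums B h≤))) (ℤₚ.+-monoˡ-< (sumℤ (take h B)) a<b))

sum-take-skip : ∀ h {a} A → Sorted (a ∷ A) → h ℕ.≤ length A →
                sumℤ (take h (a ∷ A)) ≤ sumℤ (take h A)
sum-take-skip zero    A       _                 _          = ℤₚ.≤-refl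
sum-take-skip (suc h) (b ∷ A) ((a<b ∷ _) ∷ sA) (ℕ.s≤s h≤) =
  ℤₚ.+-mono-≤ (ℤₚ.<⇒≤ a<b) (sum-take-skip h A sA h≤)

Sums-lower : ∀ {h A s} → Sorted A → Sums h A s → sumℤ (take h A) ≤ s
Sums-lower {zero}  _ ([] , _ , refl , refl) = ℤₚ.≤-refl
Sums-lower {suc h} (_ ∷ sA) (b ∷ B , refl ∷ B⊆A , refl , refl) =
  ℤₚ.+-monoʳ-≤ b (Sums-lower sA (B , B⊆A , refl , refl))
Sums-lower {suc h} {a ∷ A} sA@(_ ∷ sA′) (b ∷ B , _ ∷ʳ B⊆A , eq , refl) =
  ℤₚ.≤-trans
    (sum-take-skip (suc h) A sA (subst (ℕ._≤ length A) eq (Subₚ.length-mono-≤ B⊆A)))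
    (Sums-lower sA′ (b ∷ B , B⊆A , eq , refl))

-- Complement and negation of sumsets

complement : ∀ {B A : List ℤ} → B ⊆ A → Σ (List ℤ) λ B′ →
             B′ ⊆ A × length B ℕ.+ length B′ ≡ length A × sumℤ A - sumℤ B ≡ sumℤ B′
complement [] = [] , [] , refl , refl
complement {B} (a ∷ʳ B⊆A) with complement B⊆A
... | B′ , B′⊆A , l , s = a ∷ B′ , refl ∷ B′⊆A , trans (ℕₚ.+-suc (length B) _) (cong suc l)
                        , trans (ℤₚ.+-assoc a _ _) (cong (ℤ._+_ a) s)
complement {b ∷ B} {.b ∷ A} (refl ∷ B⊆A) with complement B⊆A
... | B′ , B′⊆A , l , s = B′ , b ∷ʳ B′⊆A , cong suc l , trans (cancel b (sumℤ A) (sumℤ B)) s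
  where
  cancel : ∀ x y z → (x + y) - (x + z) ≡ y - z
  cancel = solve-∀

Sums-complement : ∀ {h g A s} → length A ≡ h ℕ.+ g → Sums h A s → Sums g A (sumℤ A - s)
Sums-complement {h} len (B , B⊆A , refl , refl) with complement B⊆A
... | B′ , B′⊆A , l , s = B′ , B′⊆A , ℕₚ.+-cancelˡ-≡ h _ _ (trans l len) , sym s

mirror : List ℤ → List ℤ
mirror A = reverse (map ℤ.-_ A)

sum-++ : ∀ A B → sumℤ (A ++ B) ≡ sumℤ A + sumℤ B
sum-++ []      B = sym (ℤₚ.+-identityˡ _)
sum-++ (a ∷ A) B = trans (cong (ℤ._+_ a) (sum-++ A B)) (sym (ℤₚ.+-assoc a _ _))

mirror-∷ : ∀ a A → mirror (a ∷ A) ≡ mirror A ++ [ - a ]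
mirror-∷ a A = Listₚ.unfold-reverse (- a) (map ℤ.-_ A)

mirror-++ : ∀ A B → mirror (A ++ B) ≡ mirror B ++ mirror A
mirror-++ A B = trans (cong reverse (Listₚ.map-++ ℤ.-_ A B)) (Listₚ.reverse-++ (map ℤ.-_ A) (map ℤ.-_ B))

length-mirror : ∀ A → length (mirror A) ≡ length A
length-mirror A = trans (Listₚ.length-reverse (map ℤ.-_ A)) (Listₚ.length-map ℤ.-_ A)

mirror-involutive : ∀ A → mirror (mirror A) ≡ A
mirror-involutive A = begin
  reverse (map ℤ.-_ (reverse (map ℤ.-_ A))) ≡⟨ cong reverse (Listₚ.reverse-map ℤ.-_ (map ℤ.-_ A)) ⟩
  reverse (reverse (map ℤ.-_ (map ℤ.-_ A))) ≡⟨ Listₚ.reverse-involutive _ ⟩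
  map ℤ.-_ (map ℤ.-_ A)                     ≡⟨ Listₚ.map-∘ A ⟨
  map (λ a → - - a) A                       ≡⟨ Listₚ.map-cong ℤₚ.neg-involutive A ⟩
  map (λ x → x) A                       ≡⟨ Listₚ.map-id A ⟩
  A                                     ∎
  where open ≡-Reasoning

sum-mirror : ∀ A → sumℤ (mirror A) ≡ - sumℤ A
sum-mirror []      = refl
sum-mirror (a ∷ A) = begin
  sumℤ (mirror (a ∷ A))       ≡⟨ cong sumℤ (mirror-∷ a A) ⟩
  sumℤ (mirror A ++ [ - a ])  ≡⟨ sum-++ (mirror A) [ - a ] ⟩
  sumℤ (mirror A) + (- a + + 0) ≡⟨ cong (_+ (- a + + 0)) (sum-mirror A) ⟩
  - sumℤ A + (- a + + 0)      ≡⟨ swap a (sumℤ A) ⟩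
  - (a + sumℤ A)              ∎
  where
  open ≡-Reasoning
  swap : ∀ x y → - y + (- x + + 0) ≡ - (x + y)
  swap = solve-∀

Sums-mirror : ∀ {h A s} → Sums h A s → Sums h (mirror A) (+ 0 - s)
Sums-mirror (B , B⊆A , refl , refl) =
  mirror B , Subₚ.reverse⁺ (Subₚ.map⁺ ℤ.-_ B⊆A) , length-mirror B ,
  trans (sum-mirror B) (sym (ℤₚ.+-identityˡ _))

Sorted-++⁻ˡ : ∀ A {B} → Sorted (A ++ B) → Sorted A
Sorted-++⁻ˡ []      _        = []
Sorted-++⁻ˡ (a ∷ A) (p ∷ ps) = Allₚ.++⁻ˡ A p ∷ Sorted-++⁻ˡ A ps

Sorted-++⁻ʳ : ∀ A {B} → Sorted (A ++ B) → Sorted B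
Sorted-++⁻ʳ []      s        = s
Sorted-++⁻ʳ (a ∷ A) (_ ∷ ps) = Sorted-++⁻ʳ A ps

Sorted-mirror : ∀ {A} → Sorted A → Sorted (mirror A)
Sorted-mirror []                = []
Sorted-mirror {a ∷ A} (p ∷ ps) = subst Sorted (sym (mirror-∷ a A))
  (AllPairsₚ.++⁺ (Sorted-mirror ps) ([] ∷ [])
    (All.map (_∷ []) (Permₚ.All-resp-↭ (↭-sym (Permₚ.↭-reverse _)) (Allₚ.map⁺ (All.map ℤₚ.neg-mono-< p)))))

-- A chain of e + 1 + h g sums exceeds by e the minimal cardinality 1 + h g of h^A when |A| = h + g.
Excess : ℕ → ℕ → ℕ → List ℤ → Set
Excess e h g A = Σ ℤ λ s → Σ ℤ λ t → Chain (Sums h A) (h ℕ.* g ℕ.+ suc e) s t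

Excess-complement : ∀ {e h g A} → length A ≡ h ℕ.+ g → Excess e h g A → Excess e g h A
Excess-complement {e} {h} {g} {A} len (s , t , c) =
  _ , _ , Chain-length (cong (ℕ._+ suc e) (ℕₚ.*-comm h g))
            (Chain-flip (sumℤ A) (Sums-complement len) c)

Excess-mirror : ∀ {e h g A} → Excess e h g A → Excess e h g (mirror A)
Excess-mirror (s , t , c) = _ , _ , Chain-flip (+ 0) Sums-mirror c

-- The `h` sums of `shift-chain` all contain `a` and lie below the least sum avoiding `a`, to which
-- the given chain is raised. The chain grows by `h`, exactly as `1 + h g` does.
Excess-skip : ∀ {e h g a A} → Sorted (a ∷ A) → length A ≡ h ℕ.+ g →
              Excess e h g A → Excess e h (suc g) (a ∷ A)
Excess-skip {e} {h} {g} {a} {A} sA@(_ ∷ sA′) len (s , t , c) with Chain-raise (Sums-lower sA′) c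
... | t′ , c′ = _ , t′ , Chain-length (count h g e)
    (shift-chain A sA (subst (h ℕ.≤_) (sym len) (ℕₚ.m≤m+n h g)) ⟨++⟩ Chain-⊆ skip c′)
  where
  count : ∀ h g e → h ℕ.+ (h ℕ.* g ℕ.+ suc e) ≡ h ℕ.* suc g ℕ.+ suc e
  count = ℕSolver.solve-∀

-- A kept `a` is a skipped element of the complement, so `Excess-skip` applies with `h` and `g`
-- exchanged.
Excess-keep : ∀ {e h g a A} → Sorted (a ∷ A) → length A ≡ h ℕ.+ g →
              Excess e h g A → Excess e (suc h) g (a ∷ A)
Excess-keep {h = h} {g} sA len x =
  Excess-complement (trans (cong suc len) (trans (cong suc (ℕₚ.+-comm h g)) (sym (ℕₚ.+-suc g h))))
    (Excess-skip sA (trans len (ℕₚ.+-comm h g)) (Excess-complement len x))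

Excess-++ˡ : ∀ {e h g A} i j U → length U ≡ i ℕ.+ j → Sorted (U ++ A) → length A ≡ h ℕ.+ g →
             Excess e h g A → Excess e (i ℕ.+ h) (j ℕ.+ g) (U ++ A)
Excess-++ˡ zero    zero    []      _   _         _   x = x
Excess-++ˡ {h = h} {g} {A} zero (suc j) (u ∷ U) lU sA@(_ ∷ sA′) lA x =
  Excess-skip sA len (Excess-++ˡ zero j U (ℕₚ.suc-injective lU) sA′ lA x)
  where
  len : length (U ++ A) ≡ h ℕ.+ (j ℕ.+ g)
  len = trans (Listₚ.length-++ U) (trans (cong₂ ℕ._+_ (ℕₚ.suc-injective lU) lA) (lemma j h g))
    where
    lemma : ∀ j h g → j ℕ.+ (h ℕ.+ g) ≡ h ℕ.+ (j ℕ.+ g)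
    lemma = ℕSolver.solve-∀
Excess-++ˡ {h = h} {g} {A} (suc i) j (u ∷ U) lU sA@(_ ∷ sA′) lA x =
  Excess-keep sA len (Excess-++ˡ i j U (ℕₚ.suc-injective lU) sA′ lA x)
  where
  len : length (U ++ A) ≡ i ℕ.+ h ℕ.+ (j ℕ.+ g)
  len = trans (Listₚ.length-++ U) (trans (cong₂ ℕ._+_ (ℕₚ.suc-injective lU) lA) (lemma i j h g))
    where
    lemma : ∀ i j h g → i ℕ.+ j ℕ.+ (h ℕ.+ g) ≡ i ℕ.+ h ℕ.+ (j ℕ.+ g)
    lemma = ℕSolver.solve-∀

-- Negation turns appending on the right into prepending on the left.
Excess-++ʳ : ∀ {e h g A} i j V → length V ≡ i ℕ.+ j → Sorted (A ++ V) → length A ≡ h ℕ.+ g →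
             Excess e h g A → Excess e (i ℕ.+ h) (j ℕ.+ g) (A ++ V)
Excess-++ʳ {A = A} i j V lV sA lA x =
  subst (Excess _ _ _) (trans (cong mirror (sym (mirror-++ A V))) (mirror-involutive (A ++ V)))
    (Excess-mirror
      (Excess-++ˡ i j (mirror V) (trans (length-mirror V) lV)
        (subst Sorted (mirror-++ A V) (Sorted-mirror sA))
        (trans (length-mirror A) lA) (Excess-mirror x)))

-- Windows of eight or nine consecutive elements with four summands

-- A Boolean mask selects a subset of a list; move i replaces the selected i-th element by the
-- unselected (i + 1)-st one (indices from 0).
gap : ℕ → List ℤ → ℤ
gap zero    (x ∷ y ∷ _) = y - x
gap (suc i) (_ ∷ xs)    = gap i xs
gap _       _           = + 0

pick : List Bool → List ℤ → List ℤ
pick (true ∷ m)  (x ∷ xs) = x ∷ pick m xs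
pick (false ∷ m) (_ ∷ xs) = pick m xs
pick _           _        = []

ones : List Bool → ℕ
ones []          = 0
ones (true ∷ m)  = suc (ones m)
ones (false ∷ m) = ones m

movable : ℕ → List Bool → Bool
movable zero    (true ∷ false ∷ _) = true
movable (suc i) (_ ∷ m)            = movable i m
movable _       _                  = false

move : ℕ → List Bool → List Bool
move zero    (true ∷ false ∷ m) = false ∷ true ∷ m
move (suc i) (b ∷ m)            = b ∷ move i m
move _       m                  = m

moves : List ℕ → List Bool → List Bool
moves []       m = m
moves (i ∷ is) m = moves is (move i m)

legal : List ℕ → List Bool → Bool
legal []       _ = true
legal (i ∷ is) m = movable i m ∧ legal is (move i m)

length-move : ∀ i m → length (move i m) ≡ length m
length-move zero    (true ∷ false ∷ m) = refl
length-move zero    []                 = refl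
length-move zero    (true ∷ [])        = refl
length-move zero    (true ∷ true ∷ m)  = refl
length-move zero    (false ∷ m)        = refl
length-move (suc i) []                 = refl
length-move (suc i) (b ∷ m)            = cong suc (length-move i m)

ones-move : ∀ i m → ones (move i m) ≡ ones m
ones-move zero    (true ∷ false ∷ m) = refl
ones-move zero    []                 = refl
ones-move zero    (true ∷ [])        = refl
ones-move zero    (true ∷ true ∷ m)  = refl
ones-move zero    (false ∷ m)        = refl
ones-move (suc i) []                 = refl
ones-move (suc i) (true ∷ m)         = cong suc (ones-move i m)
ones-move (suc i) (false ∷ m)        = ones-move i m

sum-move : ∀ i m W → T (movable i m) → length m ≡ length W →
           sumℤ (pick (move i m) W) ≡ gap i W + sumℤ (pick m W)
sum-move zero (true ∷ false ∷ m) (x ∷ y ∷ W) _ _ = lemma x y (sumℤ (pick m W))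
  where
  lemma : ∀ x y s → y + s ≡ (y - x) + (x + s)
  lemma = solve-∀
sum-move (suc i) (true ∷ m)  (x ∷ W) ok len =
  trans (cong (ℤ._+_ x) (sum-move i m W ok (ℕₚ.suc-injective len))) (lemma x (gap i W) _)
  where
  lemma : ∀ x g s → x + (g + s) ≡ g + (x + s)
  lemma = solve-∀
sum-move (suc i) (false ∷ m) (x ∷ W) ok len = sum-move i m W ok (ℕₚ.suc-injective len)

0<y-x : ∀ {x y} → x < y → + 0 < y - x
0<y-x {x} {y} x<y = subst (_< y - x) (ℤₚ.+-inverseʳ x) (ℤₚ.+-monoˡ-< (- x) x<y)

gap-positive : ∀ i m {W} → T (movable i m) → length m ≡ length W → Sorted W → + 0 < gap i W
gap-positive zero    (true ∷ false ∷ m) {x ∷ y ∷ W} _  _   ((x<y ∷ _) ∷ _) = 0<y-x x<y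
gap-positive (suc i) (_ ∷ m)            {x ∷ W}     ok len (_ ∷ sW)        =
  gap-positive i m ok (ℕₚ.suc-injective len) sW

pick-∈Sums : ∀ m W → length m ≡ length W → Sums (ones m) W (sumℤ (pick m W))
pick-∈Sums []          []      _   = [] , [] , refl , refl
pick-∈Sums (true ∷ m)  (x ∷ W) len = keep (pick-∈Sums m W (ℕₚ.suc-injective len))
pick-∈Sums (false ∷ m) (x ∷ W) len = skip (pick-∈Sums m W (ℕₚ.suc-injective len))

<-+ : ∀ {x} y → + 0 < x → y < x + y
<-+ {x} y 0<x = subst (_< x + y) (ℤₚ.+-identityˡ y) (ℤₚ.+-monoˡ-< y 0<x)

OneToThree : ℤ → ℤ → Set
OneToThree c x = x ≡ c ⊎ x ≡ c + c ⊎ x ≡ c + (c + c)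

-- The sums v + {0, c, 2c, 3c} and x + v + {0, c, 2c, 3c} are distinct unless x ∈ {c, 2c, 3c}.
interleave : ∀ {P : ℤ → Set} {v x c} → + 0 < x → + 0 < c →
             P v → P (c + v) → P (c + (c + v)) → P (c + (c + (c + v))) →
             P (x + v) → P (x + (c + v)) → P (x + (c + (c + v))) →
             OneToThree c x ⊎ Chain P 7 v (x + (c + (c + (c + v))))
interleave {P} {v} {x} {c} 0<x 0<c p₀ p₁ p₂ p₃ q₀ q₁ q₂ = result
  where
  up : ∀ {y} → y < c + y
  up = <-+ _ 0<c
  xup : ∀ {y z} → y < z → x + y < x + z
  xup = ℤₚ.+-monoʳ-< x
  over₁ : c < x → ∀ y → c + y < x + y
  over₁ c<x y = ℤₚ.+-monoˡ-< y c<x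
  under₁ : x < c → ∀ y → x + y < c + y
  under₁ x<c y = ℤₚ.+-monoˡ-< y x<c
  over₂ : c + c < x → ∀ y → c + (c + y) < x + y
  over₂ l y = subst (_< x + y) (ℤₚ.+-assoc c c y) (ℤₚ.+-monoˡ-< y l)
  under₂ : x < c + c → ∀ y → x + y < c + (c + y)
  under₂ l y = subst (x + y <_) (ℤₚ.+-assoc c c y) (ℤₚ.+-monoˡ-< y l)
  assoc₃ : ∀ c y → c + (c + c) + y ≡ c + (c + (c + y))
  assoc₃ = solve-∀
  over₃ : c + (c + c) < x → ∀ y → c + (c + (c + y)) < x + y
  over₃ l y = subst (_< x + y) (assoc₃ c y) (ℤₚ.+-monoˡ-< y l)
  under₃ : x < c + (c + c) → ∀ y → x + y < c + (c + (c + y))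
  under₃ l y = subst (x + y <_) (assoc₃ c y) (ℤₚ.+-monoˡ-< y l)
  result : OneToThree c x ⊎ Chain P 7 v (x + (c + (c + (c + v))))
  result with ℤₚ.<-cmp x c | ℤₚ.<-cmp x (c + c) | ℤₚ.<-cmp x (c + (c + c))
  ... | tri≈ _ e _ | _ | _ = inj₁ (inj₁ e)
  ... | _ | tri≈ _ e _ | _ = inj₁ (inj₂ (inj₁ e))
  ... | _ | _ | tri≈ _ e _ = inj₁ (inj₂ (inj₂ e))
  ... | tri< l _ _ | _ | _ = inj₂
    (single p₀ (<-+ v 0<x) ⟨++⟩ single q₀ (under₁ l _) ⟨++⟩ single p₁ (<-+ _ 0<x) ⟨++⟩
     single q₁ (under₁ l _) ⟨++⟩ single p₂ (<-+ _ 0<x) ⟨++⟩ single q₂ (under₁ l _) ⟨++⟩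
     single p₃ (<-+ _ 0<x))
  ... | tri> _ _ l₁ | tri< l₂ _ _ | _ = inj₂
    (single p₀ up ⟨++⟩ single p₁ (over₁ l₁ _) ⟨++⟩ single q₀ (under₂ l₂ _) ⟨++⟩
     single p₂ (over₁ l₁ _) ⟨++⟩ single q₁ (under₂ l₂ _) ⟨++⟩ single p₃ (over₁ l₁ _) ⟨++⟩
     single q₂ (xup up))
  ... | tri> _ _ _ | tri> _ _ l₂ | tri< l₃ _ _ = inj₂
    (single p₀ up ⟨++⟩ single p₁ up ⟨++⟩ single p₂ (over₂ l₂ _) ⟨++⟩
     single q₀ (under₃ l₃ _) ⟨++⟩ single p₃ (over₂ l₂ _) ⟨++⟩ single q₁ (xup up) ⟨++⟩
     single q₂ (xup up))
  ... | tri> _ _ _ | tri> _ _ _ | tri> _ _ l₃ = inj₂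
    (single p₀ up ⟨++⟩ single p₁ up ⟨++⟩ single p₂ up ⟨++⟩ single p₃ (over₃ l₃ _) ⟨++⟩
     single q₀ (xup up) ⟨++⟩ single q₁ (xup up) ⟨++⟩ single q₂ (xup up))

module Window (W : List ℤ) (sW : Sorted W) where

  Mask : ℕ → List Bool → Set
  Mask h m = length m ≡ length W × ones m ≡ h

  value : List Bool → ℤ
  value m = sumℤ (pick m W)

  value-∈ : ∀ {h} m → Mask h m → Sums h W (value m)
  value-∈ m (len , refl) = pick-∈Sums m W len

  Mask-move : ∀ {h} i m → Mask h m → Mask h (move i m)
  Mask-move i m (len , refl) = trans (length-move i m) len , ones-move i m

  Mask-moves : ∀ {h} is m → Mask h m → Mask h (moves is m)
  Mask-moves []       m M = M
  Mask-moves (i ∷ is) m M = Mask-moves is (move i m) (Mask-move i m M)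

  value-< : ∀ i m → T (movable i m) → length m ≡ length W → value m < value (move i m)
  value-< i m ok len =
    subst (value m <_) (sym (sum-move i m W ok len)) (<-+ _ (gap-positive i m ok len sW))

  walk : ∀ {h} m → Mask h m → ∀ is → T (legal is m) →
         Chain (Sums h W) (length is) (value m) (value (moves is m))
  walk m M []       _  = stop ℤₚ.≤-refl
  walk m M (i ∷ is) ok with Equivalence.to T-∧ ok
  ... | ok₁ , ok₂ = step ℤₚ.≤-refl (value-∈ m M) (value-< i m ok₁ (proj₁ M))
                      (walk (move i m) (Mask-move i m M) is ok₂)

  -- If two independent moves have different lengths, then both intermediate sums lie on a chain.
  diamond : ∀ {h} i j → gap i W ≢ gap j W → ∀ m → Mask h m →
            T (movable i m ∧ movable j m ∧ movable j (move i m)) →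
            Chain (Sums h W) 3 (value m) (value (move j (move i m)))
  diamond i j gi≢gj m M ok with Equivalence.to T-∧ ok
  ... | oki , ok′ with Equivalence.to T-∧ ok′
  ... | okj , okij = subst (Chain _ 3 (value m)) (sym eij) body
    where
    v gi gj : ℤ
    v  = value m
    gi = gap i W
    gj = gap j W
    ei : value (move i m) ≡ gi + v
    ei = sum-move i m W oki (proj₁ M)
    ej : value (move j m) ≡ gj + v
    ej = sum-move j m W okj (proj₁ M)
    eij : value (move j (move i m)) ≡ gj + (gi + v)
    eij = trans (sum-move j (move i m) W okij (proj₁ (Mask-move i m M))) (cong (ℤ._+_ gj) ei)
    pi = subst (Sums _ W) ei (value-∈ (move i m) (Mask-move i m M))
    pj = subst (Sums _ W) ej (value-∈ (move j m) (Mask-move j m M))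
    0<gi = gap-positive i m oki (proj₁ M) sW
    0<gj = gap-positive j m okj (proj₁ M) sW
    body : Chain (Sums _ W) 3 v (gj + (gi + v))
    body with ℤₚ.<-cmp gi gj
    ... | tri< gi<gj _ _ = single (value-∈ m M) (<-+ v 0<gi)
                      ⟨++⟩ single pi (ℤₚ.+-monoˡ-< v gi<gj)
                      ⟨++⟩ single pj (ℤₚ.+-monoʳ-< gj (<-+ v 0<gi))
    ... | tri≈ _ gi≡gj _ = ⊥-elim (gi≢gj gi≡gj)
    ... | tri> _ _ gj<gi = single (value-∈ m M) (<-+ v 0<gj)
                      ⟨++⟩ single pj (ℤₚ.+-monoˡ-< v gj<gi)
                      ⟨++⟩ single pi (<-+ _ 0<gj)

  value-move-∈ : ∀ {h} i m → Mask h m → T (movable i m) → Sums h W (gap i W + value m)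
  value-move-∈ i m M ok = subst (Sums _ W) (sum-move i m W ok (proj₁ M))
                            (value-∈ (move i m) (Mask-move i m M))

  -- Walks and diamonds leave out their end point, so a full chain needs its last sum added.
  last-value : ∀ {h} m → Mask h m → Chain (Sums h W) 1 (value m) (+ 1 + value m)
  last-value m M = single (value-∈ m M) (<-+ (value m) (ℤ.+<+ (ℕ.s≤s ℕ.z≤n)))

  -- A walk yields one sum per move, a diamond three sums for two moves; three diamonds therefore
  -- give excess 3. On closed masks every legality condition reduces to the unit type, so that only
  -- the lists of moves have to be supplied.
  stacked-diamonds :
    ∀ {h} i j → gap i W ≢ gap j W → ∀ m → Mask h m → ∀ is₀ is₁ is₂ is₃ →
    let m₀ = moves is₀ m  ; m₁ = moves is₁ (move j (move i m₀))
        m₂ = moves is₂ (move j (move i m₁)) ; m₃ = move j (move i m₂)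
        ok = λ m → movable i m ∧ movable j m ∧ movable j (move i m) in
    T (legal is₀ m) → T (ok m₀) → T (legal is₁ (move j (move i m₀))) → T (ok m₁) →
    T (legal is₂ (move j (move i m₁))) → T (ok m₂) → T (legal is₃ m₃) →
    Chain (Sums h W) (length is₀ ℕ.+ (3 ℕ.+ (length is₁ ℕ.+ (3 ℕ.+ (length is₂ ℕ.+
                       (3 ℕ.+ (length is₃ ℕ.+ 1)))))))
          (value m) (+ 1 + value (moves is₃ m₃))
  stacked-diamonds {h} i j i≢j m M is₀ is₁ is₂ is₃ l₀ o₀ l₁ o₁ l₂ o₂ l₃ =
    walk m M is₀ l₀ ⟨++⟩ diamond i j i≢j m₀ M₀ o₀ ⟨++⟩
    walk _ (both m₀ M₀) is₁ l₁ ⟨++⟩ diamond i j i≢j m₁ M₁ o₁ ⟨++⟩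
    walk _ (both m₁ M₁) is₂ l₂ ⟨++⟩ diamond i j i≢j m₂ M₂ o₂ ⟨++⟩
    walk _ (both m₂ M₂) is₃ l₃ ⟨++⟩
    last-value (moves is₃ (move j (move i m₂))) (Mask-moves is₃ (move j (move i m₂)) (both m₂ M₂))
    where
    both : ∀ m → Mask h m → Mask h (move j (move i m))
    both m M = Mask-move j _ (Mask-move i m M)
    m₀ = moves is₀ m
    M₀ = Mask-moves is₀ m M
    m₁ = moves is₁ (move j (move i m₀))
    M₁ = Mask-moves is₁ _ (both m₀ M₀)
    m₂ = moves is₂ (move j (move i m₁))
    M₂ = Mask-moves is₂ _ (both m₁ M₁)

  -- Four moves alone yield four sums, so a chain of seven supplies the whole excess 3 at once. The
  -- eighth and largest sum is the excluded end point.
  interleave-moves :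
    ∀ {h c} i j m → Mask h m → gap j W ≡ c → gap (suc j) W ≡ c → gap (suc (suc j)) W ≡ c →
    let m₁ = move j m ; m₂ = move (suc j) m₁ ; m₃ = move (suc (suc j)) m₂ in
    T (movable j m) → T (movable (suc j) m₁) → T (movable (suc (suc j)) m₂) →
    T (movable i m) → T (movable i m₁) → T (movable i m₂) → T (movable i m₃) →
    OneToThree c (gap i W) ⊎ Chain (Sums h W) 7 (value m) (value (move i m₃))
  interleave-moves {h} {c} i j m M gⱼ gⱼ₁ gⱼ₂ o₁ o₂ o₃ i₀ i₁ i₂ i₃ =
    subst (λ t → OneToThree c x ⊎ Chain (Sums h W) 7 (value m) t) (sym end)
      (interleave (gap-positive i m i₀ (proj₁ M) sW) (subst (+ 0 <_) gⱼ (gap-positive j m o₁ (proj₁ M) sW))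
        (value-∈ m M)
        (subst (Sums h W) e₁ (value-∈ m₁ M₁))
        (subst (Sums h W) e₂ (value-∈ m₂ M₂))
        (subst (Sums h W) e₃ (value-∈ m₃ M₃))
        (value-move-∈ i m M i₀)
        (subst (λ y → Sums h W (x + y)) e₁ (value-move-∈ i m₁ M₁ i₁))
        (subst (λ y → Sums h W (x + y)) e₂ (value-move-∈ i m₂ M₂ i₂)))
    where
    x  = gap i W
    m₁ = move j m
    m₂ = move (suc j) m₁
    m₃ = move (suc (suc j)) m₂
    M₁ : Mask h m₁
    M₁ = Mask-move j m M
    M₂ : Mask h m₂
    M₂ = Mask-move (suc j) m₁ M₁
    M₃ : Mask h m₃
    M₃ = Mask-move (suc (suc j)) m₂ M₂
    e₁ : value m₁ ≡ c + value m
    e₁ = trans (sum-move j m W o₁ (proj₁ M)) (cong (_+ value m) gⱼ)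
    e₂ : value m₂ ≡ c + (c + value m)
    e₂ = trans (sum-move (suc j) m₁ W o₂ (proj₁ M₁)) (cong₂ _+_ gⱼ₁ e₁)
    e₃ : value m₃ ≡ c + (c + (c + value m))
    e₃ = trans (sum-move (suc (suc j)) m₂ W o₃ (proj₁ M₂)) (cong₂ _+_ gⱼ₂ e₂)
    end : value (move i m₃) ≡ x + (c + (c + (c + value m)))
    end = trans (sum-move i m₃ W i₃ (proj₁ M₃)) (cong (ℤ._+_ x) e₃)

¬≢⇒≡ : ∀ {x y : ℤ} → ¬ (x ≢ y) → x ≡ y
¬≢⇒≡ {x} {y} ¬x≢y with x ℤ.≟ y
... | yes x≡y = x≡y
... | no  x≢y = ⊥-elim (¬x≢y x≢y)

start : ℕ → List Bool
start g = true ∷ true ∷ true ∷ true ∷ replicate g false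

-- From `{0,1,2,3}` to `{5,6,7,8}` the gaps 0 to 7 are crossed 1, 2, 3, 4, 4, 3, 2, 1 times, so gaps
-- 2 to 5 are those with room for three diamonds. Moves `i` and `suc i` are never possible in the
-- same mask, since one wants position `suc i` free and the other wants it occupied; adjacent gaps
-- are therefore compared through further ones.
inner-gaps : ∀ {a₀ a₁ a₂ a₃ a₄ a₅ a₆ a₇ a₈} →
             let W = a₀ ∷ a₁ ∷ a₂ ∷ a₃ ∷ a₄ ∷ a₅ ∷ a₆ ∷ a₇ ∷ a₈ ∷ [] in
             Sorted W → ¬ Excess 3 4 5 W →
             gap 2 W ≡ gap 3 W × gap 3 W ≡ gap 4 W × gap 4 W ≡ gap 5 W
inner-gaps {a₀} {a₁} {a₂} {a₃} {a₄} {a₅} {a₆} {a₇} {a₈} sW ¬e =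
  trans g₂₅ (sym g₃₅) , trans g₃₅ (trans (sym g₂₅) g₂₄) , trans (sym g₂₄) g₂₅
  where
  W = a₀ ∷ a₁ ∷ a₂ ∷ a₃ ∷ a₄ ∷ a₅ ∷ a₆ ∷ a₇ ∷ a₈ ∷ []
  open Window W sW
  g₂₄ : gap 2 W ≡ gap 4 W
  -- Each of the first three lists ends with positions 2 and 4 occupied and 3 and 5 free, ready for
  -- a diamond; the last list completes the chain. All three crossings of gap 2 happen inside the
  -- diamonds.
  g₂₄ = ¬≢⇒≡ λ ≢ → ¬e (_ , _ , stacked-diamonds 2 4 ≢ (start 5) (refl , refl)
    (3 ∷ []) (5 ∷ 3 ∷ 1 ∷ []) (6 ∷ 5 ∷ 3 ∷ 0 ∷ 1 ∷ []) (3 ∷ 7 ∷ 6 ∷ 5 ∷ 4 ∷ []) _ _ _ _ _ _ _)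
  g₃₅ : gap 3 W ≡ gap 5 W
  g₃₅ = ¬≢⇒≡ λ ≢ → ¬e (_ , _ , stacked-diamonds 3 5 ≢ (start 5) (refl , refl)
    (3 ∷ 2 ∷ 1 ∷ 0 ∷ 4 ∷ []) (6 ∷ 4 ∷ 2 ∷ []) (7 ∷ 6 ∷ 4 ∷ 1 ∷ 2 ∷ []) (4 ∷ []) _ _ _ _ _ _ _)
  g₂₅ : gap 2 W ≡ gap 5 W
  g₂₅ = ¬≢⇒≡ λ ≢ → ¬e (_ , _ , stacked-diamonds 2 5 ≢ (start 5) (refl , refl)
    (3 ∷ 4 ∷ []) (6 ∷ 3 ∷ 4 ∷ 1 ∷ []) (7 ∷ 6 ∷ 3 ∷ 4 ∷ 0 ∷ 1 ∷ []) (3 ∷ 4 ∷ []) _ _ _ _ _ _ _)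

-- Gaps 0 and 1 are crossed only once and twice. One crossing suffices here, because another element
-- can run through the equal gaps 4, 5, 6 independently of it: `{0,2,3,r}` is set against
-- `{1,2,3,r}` for gap 0, and `{0,1,3,r}` against `{0,2,3,r}` for gap 1, with `r` from 4 to 7.
end-gaps : ∀ {a₀ a₁ a₂ a₃ a₄ a₅ a₆ a₇ c} →
           let W = a₀ ∷ a₁ ∷ a₂ ∷ a₃ ∷ a₄ ∷ a₅ ∷ a₆ ∷ a₇ ∷ [] in
           Sorted W → gap 4 W ≡ c → gap 5 W ≡ c → gap 6 W ≡ c → ¬ Excess 3 4 4 W →
           OneToThree c (gap 0 W) × OneToThree c (gap 1 W)
end-gaps {a₀} {a₁} {a₂} {a₃} {a₄} {a₅} {a₆} {a₇} {c} sW g₄ g₅ g₆ ¬e = first , second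
  where
  W = a₀ ∷ a₁ ∷ a₂ ∷ a₃ ∷ a₄ ∷ a₅ ∷ a₆ ∷ a₇ ∷ []
  open Window W sW
  m₀ = start 4
  first : OneToThree c (gap 0 W)
  first with interleave-moves 0 4 (moves (3 ∷ 2 ∷ 1 ∷ []) m₀) (refl , refl) g₄ g₅ g₆ _ _ _ _ _ _ _
  ... | inj₁ x = x
  ... | inj₂ ch = ⊥-elim (¬e (_ , _ ,
    walk m₀ (refl , refl) (3 ∷ 2 ∷ 1 ∷ []) _ ⟨++⟩ ch ⟨++⟩
    walk (moves (3 ∷ 2 ∷ 1 ∷ 4 ∷ 5 ∷ 6 ∷ 0 ∷ []) m₀) (refl , refl)
      (3 ∷ 4 ∷ 5 ∷ 2 ∷ 3 ∷ 4 ∷ 1 ∷ 2 ∷ 3 ∷ []) _ ⟨++⟩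
    last-value (false ∷ false ∷ false ∷ false ∷ true ∷ true ∷ true ∷ true ∷ []) (refl , refl)))
  second : OneToThree c (gap 1 W)
  second with interleave-moves 1 4 (moves (3 ∷ 2 ∷ []) m₀) (refl , refl) g₄ g₅ g₆ _ _ _ _ _ _ _
  ... | inj₁ x = x
  ... | inj₂ ch = ⊥-elim (¬e (_ , _ ,
    walk m₀ (refl , refl) (3 ∷ 2 ∷ []) _ ⟨++⟩ ch ⟨++⟩
    walk (moves (3 ∷ 2 ∷ 4 ∷ 5 ∷ 6 ∷ 1 ∷ []) m₀) (refl , refl)
      (3 ∷ 4 ∷ 5 ∷ 2 ∷ 3 ∷ 4 ∷ 0 ∷ 1 ∷ 2 ∷ 3 ∷ []) _ ⟨++⟩
    last-value (false ∷ false ∷ false ∷ false ∷ true ∷ true ∷ true ∷ true ∷ []) (refl , refl)))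

-- The shape of the set

-- The elements on the two sides of a window must be declared summands or non-summands, `H` and `G`
-- of them in all. Any division would do; this one places the summands on the left as long as there
-- is room.
split-two-ways : ∀ u v H G → u ℕ.+ v ≡ H ℕ.+ G →
                 Σ ℕ λ i → Σ ℕ λ j → Σ ℕ λ i′ → Σ ℕ λ j′ →
                 u ≡ i ℕ.+ j × v ≡ i′ ℕ.+ j′ × i ℕ.+ i′ ≡ H × j ℕ.+ j′ ≡ G
split-two-ways zero    v H       G eq = 0 , 0 , H , G , refl , eq , refl , refl
split-two-ways (suc u) v zero    G eq = 0 , suc u , 0 , v , refl , refl , refl , eq
split-two-ways (suc u) v (suc H) G eq with split-two-ways u v H G (ℕₚ.suc-injective eq)
... | i , j , i′ , j′ , e₁ , e₂ , e₃ , e₄ = suc i , j , i′ , j′ , cong suc e₁ , e₂ , cong suc e₃ , e₄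

Excess-window : ∀ {e h g H G} U W V → Sorted (U ++ W ++ V) → length W ≡ h ℕ.+ g →
                length (U ++ W ++ V) ≡ (H ℕ.+ h) ℕ.+ (G ℕ.+ g) →
                Excess e h g W → Excess e (H ℕ.+ h) (G ℕ.+ g) (U ++ W ++ V)
Excess-window {e} {h} {g} {H} {G} U W V sA lW lA x
  with split-two-ways (length U) (length V) H G
         (ℕₚ.+-cancelʳ-≡ (h ℕ.+ g) (length U ℕ.+ length V) (H ℕ.+ G)
           (trans (sym count) (trans lA (regroup H h G g))))
  where
  regroup : ∀ H h G g → (H ℕ.+ h) ℕ.+ (G ℕ.+ g) ≡ H ℕ.+ G ℕ.+ (h ℕ.+ g)
  regroup = ℕSolver.solve-∀
  swap : ∀ a b c → a ℕ.+ (b ℕ.+ c) ≡ a ℕ.+ c ℕ.+ b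
  swap = ℕSolver.solve-∀
  count : length (U ++ W ++ V) ≡ length U ℕ.+ length V ℕ.+ (h ℕ.+ g)
  count = trans (Listₚ.length-++ U) (trans (cong (length U ℕ.+_)
              (trans (Listₚ.length-++ W) (cong (ℕ._+ length V) lW)))
            (swap (length U) (h ℕ.+ g) (length V)))
... | i , j , i′ , j′ , eU , eV , refl , refl =
  subst₂ (λ a b → Excess e a b (U ++ W ++ V)) (sym (ℕₚ.+-assoc i i′ h)) (sym (ℕₚ.+-assoc j j′ g))
    (Excess-++ˡ i j U eU sA
      (trans (Listₚ.length-++ W) (trans (cong₂ ℕ._+_ lW eV) (swap′ h g i′ j′)))
      (Excess-++ʳ i′ j′ V eV (Sorted-++⁻ʳ U sA) lW x))
  where
  swap′ : ∀ h g i j → h ℕ.+ g ℕ.+ (i ℕ.+ j) ≡ i ℕ.+ h ℕ.+ (j ℕ.+ g)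
  swap′ = ℕSolver.solve-∀

ap : ℤ → ℤ → ℕ → List ℤ
ap m c zero    = []
ap m c (suc l) = m ∷ ap (c + m) c l

at : ℤ → ℤ → ℕ → ℤ
at m c zero    = m
at m c (suc l) = at (c + m) c l

ap-++ : ∀ m c l n → ap m c (l ℕ.+ n) ≡ ap m c l ++ ap (at m c l) c n
ap-++ m c zero    n = refl
ap-++ m c (suc l) n = cong (m ∷_) (ap-++ (c + m) c l n)

InnerGapsEqual : List ℤ → Set
InnerGapsEqual W = gap 2 W ≡ gap 3 W × gap 3 W ≡ gap 4 W × gap 4 W ≡ gap 5 W

next-term : ∀ {x y c} → y - x ≡ c → y ≡ c + x
next-term {x} {y} refl = lemma x y
  where
  lemma : ∀ x y → y ≡ y - x + x
  lemma = solve-∀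

gap-term : ∀ c x → c + x - x ≡ c
gap-term = solve-∀

-- The tail has this form with end elements `b₀`, `b₁`, and the equality of gaps 2 and 3 in the
-- foremost window says that `b₁` continues the progression to the left.
ap-core : ∀ n A → length A ≡ 9 ℕ.+ n →
          (∀ U W V → A ≡ U ++ W ++ V → length W ≡ 9 → InnerGapsEqual W) →
          Σ ℤ λ a₀ → Σ ℤ λ a₁ → Σ ℤ λ m → Σ ℤ λ c → Σ ℤ λ r → Σ ℤ λ s →
          A ≡ a₀ ∷ a₁ ∷ ap m c (5 ℕ.+ n) ++ r ∷ s ∷ []
ap-core zero (a₀ ∷ a₁ ∷ a₂ ∷ a₃ ∷ a₄ ∷ a₅ ∷ a₆ ∷ a₇ ∷ a₈ ∷ []) _ inner
  with inner [] _ [] refl refl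
... | g₂₃ , g₃₄ , g₄₅ =
  a₀ , a₁ , a₂ , c , a₇ , a₈ ,
  cong (λ xs → a₀ ∷ a₁ ∷ xs ++ a₇ ∷ a₈ ∷ [])
    (terms {c = c} (next-term refl) (next-term (sym g₂₃)) (next-term (sym (trans g₂₃ g₃₄)))
           (next-term (sym (trans g₂₃ (trans g₃₄ g₄₅)))))
  where
  c = a₃ - a₂
  terms : ∀ {a₂ a₃ a₄ a₅ a₆ c} → a₃ ≡ c + a₂ → a₄ ≡ c + a₃ → a₅ ≡ c + a₄ → a₆ ≡ c + a₅ →
          a₂ ∷ a₃ ∷ a₄ ∷ a₅ ∷ a₆ ∷ [] ≡ ap a₂ c 5
  terms refl refl refl refl = refl
ap-core (suc n) (a₀ ∷ a₁ ∷ a₂ ∷ a₃ ∷ a₄ ∷ a₅ ∷ a₆ ∷ a₇ ∷ a₈ ∷ A) len inner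
  with ap-core n (a₁ ∷ a₂ ∷ a₃ ∷ a₄ ∷ a₅ ∷ a₆ ∷ a₇ ∷ a₈ ∷ A) (ℕₚ.suc-injective len)
         (λ U W V eq → inner (a₀ ∷ U) W V (cong (a₀ ∷_) eq))
     | inner [] (a₀ ∷ a₁ ∷ a₂ ∷ a₃ ∷ a₄ ∷ a₅ ∷ a₆ ∷ a₇ ∷ a₈ ∷ []) A refl refl
... | b₀ , b₁ , m , c , r , s , eq | g₂₃ , _ =
  a₀ , b₀ , b₁ , c , r , s ,
  trans (cong (a₀ ∷_) eq)
    (cong (λ x → a₀ ∷ b₀ ∷ b₁ ∷ ap x c (5 ℕ.+ n) ++ r ∷ s ∷ []) (previous {a₄ = a₄} {c = c} eq g₂₃))
  where
  previous : ∀ {a₁ a₂ a₃ a₄ b₀ b₁ m c : ℤ} {A B : List ℤ} →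
             _≡_ {A = List ℤ} (a₁ ∷ a₂ ∷ a₃ ∷ a₄ ∷ A) (b₀ ∷ b₁ ∷ m ∷ c + m ∷ B) →
             a₃ - a₂ ≡ a₄ - a₃ → m ≡ c + b₁
  previous {m = m} {c} refl g = next-term (trans g (gap-term c m))

record Shape (A : List ℤ) (n : ℕ) : Set where
  constructor shape
  field
    a₀ a₁ m c r s : ℤ
    A≡   : A ≡ a₀ ∷ a₁ ∷ ap m c (5 ℕ.+ n) ++ r ∷ s ∷ []
    gap₁ : OneToThree c (a₁ - a₀)
    gap₂ : OneToThree c (m - a₁)
    -- The last of the `5 + n` terms is `4 + n` steps after `m`.
    gap₃ : OneToThree c (r - at m c (4 ℕ.+ n))
    gap₄ : OneToThree c (s - r)

end-gaps-right : ∀ {a₀ a₁ a₂ a₃ a₄ a₅ a₆ a₇ c} →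
                 let W = a₀ ∷ a₁ ∷ a₂ ∷ a₃ ∷ a₄ ∷ a₅ ∷ a₆ ∷ a₇ ∷ [] in
                 Sorted W → gap 0 W ≡ c → gap 1 W ≡ c → gap 2 W ≡ c → ¬ Excess 3 4 4 W →
                 OneToThree c (gap 5 W) × OneToThree c (gap 6 W)
end-gaps-right {a₀} {a₁} {a₂} {a₃} {a₄} {a₅} {a₆} {a₇} {c} sW g₀ g₁ g₂ ¬e =
  subst (OneToThree c) (neg-gap a₅ a₆) (proj₂ mirrored) ,
  subst (OneToThree c) (neg-gap a₆ a₇) (proj₁ mirrored)
  where
  W = a₀ ∷ a₁ ∷ a₂ ∷ a₃ ∷ a₄ ∷ a₅ ∷ a₆ ∷ a₇ ∷ []
  neg-gap : ∀ x y → - x - - y ≡ y - x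
  neg-gap = solve-∀
  ¬e-mirror : ¬ Excess 3 4 4 (mirror W)
  ¬e-mirror x = ¬e (subst (Excess 3 4 4) (mirror-involutive W)
                     (Excess-mirror {3} {4} {4} {mirror W} x))
  mirrored : OneToThree c (- a₆ - - a₇) × OneToThree c (- a₅ - - a₆)
  mirrored = end-gaps (Sorted-mirror sW) (trans (neg-gap a₂ a₃) g₂)
               (trans (neg-gap a₁ a₂) g₁) (trans (neg-gap a₀ a₁) g₀) ¬e-mirror

no-excess₈ : ∀ H G A → Sorted A → length A ≡ (H ℕ.+ 4) ℕ.+ (G ℕ.+ 5) →
             ¬ Excess 3 (H ℕ.+ 4) (G ℕ.+ 5) A →
             ∀ U W V → A ≡ U ++ W ++ V → length W ≡ 8 → ¬ Excess 3 4 4 W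
no-excess₈ H G A sA lA ¬e U W V refl lW x =
  ¬e (subst (λ g → Excess 3 (H ℕ.+ 4) g A) (sym (ℕₚ.+-suc G 4))
       (Excess-window {G = suc G} U W V sA lW
         (trans lA (cong ((H ℕ.+ 4) ℕ.+_) (ℕₚ.+-suc G 4))) x))

-- With at least ten elements the progression has at least six terms. The first eight and the last
-- eight elements of `A` then consist of two end elements and six terms, as `end-gaps` and
-- `end-gaps-right` require.
no-excess⇒Shape : ∀ H G n A → Sorted A → length A ≡ (H ℕ.+ 4) ℕ.+ (G ℕ.+ 5) →
                  length A ≡ 10 ℕ.+ n → ¬ Excess 3 (H ℕ.+ 4) (G ℕ.+ 5) A → Shape A (suc n)
no-excess⇒Shape H G n A sA lA ln ¬e with ap-core (suc n) A ln inner
  where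
  inner : ∀ U W V → A ≡ U ++ W ++ V → length W ≡ 9 → InnerGapsEqual W
  inner U W@(_ ∷ _ ∷ _ ∷ _ ∷ _ ∷ _ ∷ _ ∷ _ ∷ _ ∷ []) V refl _ =
    inner-gaps (Sorted-++⁻ˡ W (Sorted-++⁻ʳ U sA)) (λ x → ¬e (Excess-window U W V sA refl lA x))
... | a₀ , a₁ , m , c , r , s , refl = shape a₀ a₁ m c r s refl (proj₁ left) (proj₂ left)
    (subst (λ x → OneToThree c (r - x)) last-term (proj₁ right)) (proj₂ right)
  where
  left : OneToThree c (a₁ - a₀) × OneToThree c (m - a₁)
  left = end-gaps (Sorted-++⁻ˡ W sA) (gap-term c _) (gap-term c _) (gap-term c _)
           (no-excess₈ H G _ sA lA ¬e [] W (ap _ c n ++ r ∷ s ∷ []) refl refl)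
    where
    W = a₀ ∷ a₁ ∷ ap m c 6
  m′ = at m c n
  U = a₀ ∷ a₁ ∷ ap m c n
  W = ap m′ c 6 ++ r ∷ s ∷ []
  A≡ : A ≡ U ++ W
  A≡ = cong (λ xs → a₀ ∷ a₁ ∷ xs) (trans (cong (_++ r ∷ s ∷ [])
         (trans (cong (ap m c) (ℕₚ.+-comm 6 n)) (ap-++ m c n 6)))
         (Listₚ.++-assoc (ap m c n) (ap m′ c 6) (r ∷ s ∷ [])))
  right : OneToThree c (r - at m′ c 5) × OneToThree c (s - r)
  right = end-gaps-right {c = c} (Sorted-++⁻ʳ U (subst Sorted A≡ sA))
            (gap-term c _) (gap-term c _) (gap-term c _)
            (no-excess₈ H G _ sA lA ¬e U W [] (trans A≡ (cong (U ++_) (sym (Listₚ.++-identityʳ W)))) refl)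
  at-+ : ∀ m l n → at (at m c l) c n ≡ at m c (l ℕ.+ n)
  at-+ m zero    n = refl
  at-+ m (suc l) n = at-+ (c + m) l n
  last-term : at m′ c 5 ≡ at m c (5 ℕ.+ n)
  last-term = trans (at-+ m n 5) (cong (at m c) (ℕₚ.+-comm n 5))

OneToThree⇒∣ : ∀ {c x} → OneToThree c x → c ℤ∣ x
OneToThree⇒∣ (inj₁ refl)        = ℤDiv.∣-refl
OneToThree⇒∣ (inj₂ (inj₁ refl)) = ℤDiv.∣m∣n⇒∣m+n ℤDiv.∣-refl ℤDiv.∣-refl
OneToThree⇒∣ (inj₂ (inj₂ refl)) =
  ℤDiv.∣m∣n⇒∣m+n ℤDiv.∣-refl (ℤDiv.∣m∣n⇒∣m+n ℤDiv.∣-refl ℤDiv.∣-refl)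

∣-step : ∀ {c x y} → c ℤ∣ x → c ℤ∣ y - x → c ℤ∣ y
∣-step {c} {x} {y} c∣x c∣y-x = subst (c ℤ∣_) (lemma x y) (ℤDiv.∣m∣n⇒∣m+n c∣y-x c∣x)
  where
  lemma : ∀ x y → y - x + x ≡ y
  lemma = solve-∀

∣-zero : ∀ c → c ℤ∣ + 0
∣-zero c = ℤDiv.∣ᵤ⇒∣ (∣ c ∣ ℕDiv.∣0)

ap-∣ : ∀ {m c} l → c ℤ∣ m → All (c ℤ∣_) (ap m c l)
ap-∣ zero    c∣m = []
ap-∣ (suc l) c∣m = c∣m ∷ ap-∣ l (ℤDiv.∣m∣n⇒∣m+n ℤDiv.∣-refl c∣m)

at-∣ : ∀ {m c} l → c ℤ∣ m → c ℤ∣ at m c l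
at-∣ zero    c∣m = c∣m
at-∣ (suc l) c∣m = at-∣ l (ℤDiv.∣m∣n⇒∣m+n ℤDiv.∣-refl c∣m)

gcdList-greatest : ∀ {c} A → All (c ℤ∣_) A → ∣ c ∣ ℕDiv.∣ gcdList A
gcdList-greatest []      []        = _ ℕDiv.∣0
gcdList-greatest (a ∷ A) (c∣a ∷ p) = gcd-greatest (ℤDiv.∣⇒∣ᵤ c∣a) (gcdList-greatest A p)

Small : ℕ → Set
Small a = a ≡ 1 ⊎ a ≡ 2 ⊎ a ≡ 3

OneToThree⇒Small : ∀ x y → OneToThree (+ 1) (y - x) → Σ ℕ λ a → Small a × y ≡ + a + x
OneToThree⇒Small _ _ (inj₁ e)        = 1 , inj₁ refl , next-term e
OneToThree⇒Small _ _ (inj₂ (inj₁ e)) = 2 , inj₂ (inj₁ refl) , next-term e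
OneToThree⇒Small _ _ (inj₂ (inj₂ e)) = 3 , inj₂ (inj₂ refl) , next-term e

-- The parameters are the gaps in order: `α`, `β`, then `l` unit gaps, then `γ`, `δ`.
model : ℕ → ℕ → ℕ → ℕ → ℕ → List ℤ
model α β γ δ l = + 0 ∷ + α ∷ ap (+ (β ℕ.+ α)) (+ 1) (suc l) ++
                  + (γ ℕ.+ (l ℕ.+ (β ℕ.+ α))) ∷ + (δ ℕ.+ (γ ℕ.+ (l ℕ.+ (β ℕ.+ α)))) ∷ []

at-unit : ∀ m l → at (+ m) (+ 1) l ≡ + (l ℕ.+ m)
at-unit m zero    = refl
at-unit m (suc l) = trans (at-unit (suc m) l) (cong +_ (ℕₚ.+-suc l m))

positive-unit : ∀ {c} → + 0 < c → ∣ c ∣ ≡ 1 → c ≡ + 1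
positive-unit {+ 1} _ refl = refl

-- The difference `c` divides `a₀`, which is 0, and every gap, hence every element; primitivity and
-- positivity leave only `c` equal to 1.
Shape⇒model : ∀ {n} A → Sorted A → + 0 ∈ A → (∀ a → a ∈ A → + 0 ≤ a) →
              (∀ c → All (c ℤ∣_) A → ∣ c ∣ ≡ 1) → Shape A n →
              Σ ℕ λ α → Σ ℕ λ β → Σ ℕ λ γ → Σ ℕ λ δ →
              Small α × Small β × Small γ × Small δ × A ≡ model α β γ δ (4 ℕ.+ n)
Shape⇒model {n} A sA 0∈A 0≤A prim (shape a₀ a₁ m c r s refl g₁ g₂ g₃ g₄)
  with a₀≡0 sA 0∈A (0≤A a₀ (here refl))
  where
  a₀≡0 : ∀ {a B} → Sorted (a ∷ B) → + 0 ∈ a ∷ B → + 0 ≤ a → a ≡ + 0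
  a₀≡0 _       (here e)  _   = sym e
  a₀≡0 (p ∷ _) (there q) 0≤a = ℤₚ.≤-antisym (ℤₚ.<⇒≤ (All.lookup p q)) 0≤a
... | refl with positive-unit (0<c sA) (prim c all)
  where
  0<c : ∀ {a b B} → Sorted (a ∷ b ∷ m ∷ c + m ∷ B) → + 0 < c
  0<c (_ ∷ _ ∷ (m<c+m ∷ _) ∷ _) = subst (+ 0 <_) (gap-term c m) (0<y-x m<c+m)
  ∣a₁ : c ℤ∣ a₁
  ∣a₁ = ∣-step (∣-zero c) (OneToThree⇒∣ g₁)
  ∣m : c ℤ∣ m
  ∣m = ∣-step ∣a₁ (OneToThree⇒∣ g₂)
  ∣r : c ℤ∣ r
  ∣r = ∣-step (at-∣ (4 ℕ.+ n) ∣m) (OneToThree⇒∣ g₃)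
  all : All (c ℤ∣_) (+ 0 ∷ a₁ ∷ ap m c (5 ℕ.+ n) ++ r ∷ s ∷ [])
  all = ∣-zero c ∷ ∣a₁ ∷ Allₚ.++⁺ (ap-∣ (5 ℕ.+ n) ∣m) (∣r ∷ ∣-step ∣r (OneToThree⇒∣ g₄) ∷ [])
... | refl with OneToThree⇒Small (+ 0) a₁ g₁
... | α , sα , a₁≡ with trans a₁≡ (ℤₚ.+-identityʳ (+ α))
... | refl with OneToThree⇒Small (+ α) m g₂
... | β , sβ , refl with OneToThree⇒Small (at (+ (β ℕ.+ α)) (+ 1) (4 ℕ.+ n)) r g₃
... | γ , sγ , r≡ with trans r≡ (cong (ℤ._+_ (+ γ)) (at-unit (β ℕ.+ α) (4 ℕ.+ n)))
... | refl with OneToThree⇒Small (+ (γ ℕ.+ (4 ℕ.+ n ℕ.+ (β ℕ.+ α)))) s g₄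
... | δ , sδ , refl = α , β , γ , δ , sα , sβ , sγ , sδ , refl

-- The sumset of a set with unit inner gaps

-- This is `m + (m + 1) + ... + (m + j - 1)`, the least sum of `j` distinct integers from `m` on.
S : ℕ → ℕ → ℕ
S m zero    = 0
S m (suc j) = m ℕ.+ S (suc m) j

S-∷ʳ : ∀ m j → S m (suc j) ≡ S m j ℕ.+ (m ℕ.+ j)
S-∷ʳ m zero    = refl
S-∷ʳ m (suc j) = trans (cong (m ℕ.+_) (S-∷ʳ (suc m) j)) (lemma m (S (suc m) j) j)
  where
  lemma : ∀ m s j → m ℕ.+ (s ℕ.+ (suc m ℕ.+ j)) ≡ m ℕ.+ s ℕ.+ (m ℕ.+ suc j)
  lemma = ℕSolver.solve-∀

S-shift : ∀ m d j → S (d ℕ.+ m) j ≡ S m j ℕ.+ j ℕ.* d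
S-shift m d zero    = refl
S-shift m d (suc j) = trans (cong (d ℕ.+ m ℕ.+_)
    (trans (cong (λ x → S x j) (sym (ℕₚ.+-suc d m))) (S-shift (suc m) d j)))
    (lemma m d (S (suc m) j) (j ℕ.* d))
  where
  lemma : ∀ m d s x → d ℕ.+ m ℕ.+ (s ℕ.+ x) ≡ m ℕ.+ s ℕ.+ (d ℕ.+ x)
  lemma = ℕSolver.solve-∀

sum-ap : ∀ m j → sumℤ (ap (+ m) (+ 1) j) ≡ + S m j
sum-ap m zero    = refl
sum-ap m (suc j) = cong (ℤ._+_ (+ m)) (sum-ap (suc m) j)

take-ap : ∀ {m c} a b X → take a (ap m c (a ℕ.+ b) ++ X) ≡ ap m c a
take-ap zero    b X = refl
take-ap (suc a) b X = cong (_ ∷_) (take-ap a b X)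

length-ap : ∀ m c l → length (ap m c l) ≡ l
length-ap m c zero    = refl
length-ap m c (suc l) = cong suc (length-ap (c + m) c l)

-- If the remaining terms can produce `n` by themselves, the least term is kept. Otherwise `g` is
-- positive and `n` is at least `suc j`, which is what skipping the least term adds to the least
-- sum.
Sums-ap : ∀ j g m n → n ℕ.≤ j ℕ.* g → Sums j (ap (+ m) (+ 1) (j ℕ.+ g)) (+ (S m j ℕ.+ n))
Sums-ap zero    g       m .0 ℕ.z≤n = take-∈Sums {0} (ap (+ m) (+ 1) g) ℕ.z≤n
Sums-ap (suc j) g       m n n≤ with n ℕ.≤? j ℕ.* g
... | yes n≤jg = subst (Sums (suc j) _) (cong +_ (sym (ℕₚ.+-assoc m (S (suc m) j) n)))
                   (keep (Sums-ap j g (suc m) n n≤jg))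
Sums-ap (suc j) zero    m n n≤ | no n≰ = ⊥-elim (n≰ n≤)
Sums-ap (suc j) (suc g) m n n≤ | no n≰ =
  subst₂ (Sums (suc j)) (cong (λ l → + m ∷ ap (+ suc m) (+ 1) l) (sym (ℕₚ.+-suc j g))) (cong +_ sums)
    (skip (Sums-ap (suc j) g (suc m) n′ n′≤))
  where
  n′ : ℕ
  n′ = n ℕ.∸ suc j
  suc-j≤n : suc j ℕ.≤ n
  suc-j≤n = ℕₚ.≤-trans (ℕ.s≤s (subst (j ℕ.≤_) (sym (ℕₚ.*-suc j g)) (ℕₚ.m≤m+n j _))) (ℕₚ.≰⇒> n≰)
  n≡ : suc j ℕ.+ n′ ≡ n
  n≡ = ℕₚ.m+[n∸m]≡n suc-j≤n
  n′≤ : n′ ℕ.≤ suc j ℕ.* g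
  n′≤ = ℕₚ.+-cancelˡ-≤ (suc j) n′ _ (subst₂ ℕ._≤_ (sym n≡) (ℕₚ.*-suc (suc j) g) n≤)
  sums : S (suc m) (suc j) ℕ.+ n′ ≡ S m (suc j) ℕ.+ n
  sums = trans (cong (ℕ._+ n′) (S-shift m 1 (suc j)))
           (trans (cong (λ x → S m (suc j) ℕ.+ x ℕ.+ n′) (ℕₚ.*-identityʳ (suc j)))
             (trans (ℕₚ.+-assoc (S m (suc j)) (suc j) n′) (cong (S m (suc j) ℕ.+_) n≡)))

Sums-++ : ∀ {h h′ A B s t} → Sums h A s → Sums h′ B t → Sums (h ℕ.+ h′) (A ++ B) (s + t)
Sums-++ (C , C⊆A , refl , refl) (D , D⊆B , refl , refl) =
  C ++ D , Subₚ.++⁺ C⊆A D⊆B , Listₚ.length-++ C , sum-++ C D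

Sums-upper : ∀ {h g A x} → length A ≡ h ℕ.+ g → Sorted A → Sums h A x →
             sumℤ (take g A) + x ≤ sumℤ A
Sums-upper {g = g} {A} {x} len sA x∈ =
  subst (sumℤ (take g A) + x ≤_) (lemma (sumℤ A) x)
    (ℤₚ.+-monoˡ-≤ x (Sums-lower sA (Sums-complement len x∈)))
  where
  lemma : ∀ a x → a - x + x ≡ a
  lemma = solve-∀

module Model {α β γ δ : ℕ} (j q : ℕ) where

  μ r s S₀ top : ℕ
  μ = β ℕ.+ α
  r = γ ℕ.+ (suc j ℕ.+ q ℕ.+ μ)
  s = δ ℕ.+ r
  S₀ = S μ j
  top = r ℕ.+ s ℕ.+ j ℕ.* (2 ℕ.+ q)

  A : List ℤ
  A = model α β γ δ (suc j ℕ.+ q)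

  relocate : ∀ {h h′ x y} i i′ → i ℕ.+ i′ ≡ 2 ℕ.+ j ℕ.+ q → h ≡ h′ → x ≡ y →
             Sums h (+ 0 ∷ + α ∷ ap (+ μ) (+ 1) (i ℕ.+ i′) ++ + r ∷ + s ∷ []) (+ x) →
             Sums h′ A (+ y)
  relocate i i′ eq refl refl rewrite eq = λ x → x

  middle : ∀ i i′ n → n ℕ.≤ i ℕ.* i′ → ∀ {h t} → Sums h (+ r ∷ + s ∷ []) t →
           Sums (i ℕ.+ h) (ap (+ μ) (+ 1) (i ℕ.+ i′) ++ + r ∷ + s ∷ []) (+ (S μ i ℕ.+ n) + t)
  middle i i′ n n≤ e = Sums-++ (Sums-ap i i′ μ n n≤) e

  -- The next five intervals consist of the sums with a prescribed part outside the progression: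
  -- {0, α}, {0}, ∅, {s}, {r, s}.
  segment₁ : ∀ n → n ℕ.≤ j ℕ.* (2 ℕ.+ q) → Sums (2 ℕ.+ j) A (+ (S₀ ℕ.+ (α ℕ.+ n)))
  segment₁ n n≤ = relocate j (2 ℕ.+ q) (e j q) (ℕₚ.+-identityʳ (2 ℕ.+ j)) (sums α S₀ n)
      (keep (keep (middle j (2 ℕ.+ q) n n≤ ([] , _ ∷ʳ _ ∷ʳ [] , refl , refl))))
    where
    e : ∀ j q → j ℕ.+ (2 ℕ.+ q) ≡ 2 ℕ.+ j ℕ.+ q
    e = ℕSolver.solve-∀
    sums : ∀ α S₀ n → α ℕ.+ (S₀ ℕ.+ n ℕ.+ 0) ≡ S₀ ℕ.+ (α ℕ.+ n)
    sums = ℕSolver.solve-∀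

  segment₂ : ∀ n → n ℕ.≤ suc j ℕ.* suc q → Sums (2 ℕ.+ j) A (+ (S₀ ℕ.+ (μ ℕ.+ j ℕ.+ n)))
  segment₂ n n≤ = relocate (suc j) (suc q) (e j q) (ℕₚ.+-identityʳ (2 ℕ.+ j))
      (trans (cong (λ x → x ℕ.+ n ℕ.+ 0) (S-∷ʳ μ j)) (sums S₀ (μ ℕ.+ j) n))
      (keep (skip (middle (suc j) (suc q) n n≤ ([] , _ ∷ʳ _ ∷ʳ [] , refl , refl))))
    where
    e : ∀ j q → suc j ℕ.+ suc q ≡ 2 ℕ.+ j ℕ.+ q
    e = ℕSolver.solve-∀
    sums : ∀ S₀ x n → S₀ ℕ.+ x ℕ.+ n ℕ.+ 0 ≡ S₀ ℕ.+ (x ℕ.+ n)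
    sums = ℕSolver.solve-∀

  segment₃ : ∀ n → n ℕ.≤ (2 ℕ.+ j) ℕ.* q →
             Sums (2 ℕ.+ j) A (+ (S₀ ℕ.+ (μ ℕ.+ j ℕ.+ (μ ℕ.+ suc j) ℕ.+ n)))
  segment₃ n n≤ = relocate (2 ℕ.+ j) q refl (ℕₚ.+-identityʳ (2 ℕ.+ j))
      (trans (cong (λ x → x ℕ.+ n ℕ.+ 0) (trans (S-∷ʳ μ (suc j)) (cong (ℕ._+ (μ ℕ.+ suc j)) (S-∷ʳ μ j))))
        (sums S₀ (μ ℕ.+ j) (μ ℕ.+ suc j) n))
      (skip (skip (middle (2 ℕ.+ j) q n n≤ ([] , _ ∷ʳ _ ∷ʳ [] , refl , refl))))
    where
    sums : ∀ S₀ x y n → S₀ ℕ.+ x ℕ.+ y ℕ.+ n ℕ.+ 0 ≡ S₀ ℕ.+ (x ℕ.+ y ℕ.+ n)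
    sums = ℕSolver.solve-∀

  segment₄ : ∀ n → n ℕ.≤ suc j ℕ.* suc q → Sums (2 ℕ.+ j) A (+ (S₀ ℕ.+ (s ℕ.+ (μ ℕ.+ j) ℕ.+ n)))
  segment₄ n n≤ = relocate (suc j) (suc q) (e j q) (ℕₚ.+-comm (suc j) 1)
      (trans (cong (λ x → x ℕ.+ n ℕ.+ (s ℕ.+ 0)) (S-∷ʳ μ j)) (sums S₀ (μ ℕ.+ j) n s))
      (skip (skip (middle (suc j) (suc q) n n≤ (_ , _ ∷ʳ refl ∷ [] , refl , refl))))
    where
    e : ∀ j q → suc j ℕ.+ suc q ≡ 2 ℕ.+ j ℕ.+ q
    e = ℕSolver.solve-∀
    sums : ∀ S₀ x n s → S₀ ℕ.+ x ℕ.+ n ℕ.+ (s ℕ.+ 0) ≡ S₀ ℕ.+ (s ℕ.+ x ℕ.+ n)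
    sums = ℕSolver.solve-∀

  segment₅ : ∀ n → n ℕ.≤ j ℕ.* (2 ℕ.+ q) → Sums (2 ℕ.+ j) A (+ (S₀ ℕ.+ (r ℕ.+ s ℕ.+ n)))
  segment₅ n n≤ = relocate j (2 ℕ.+ q) (e j q) (ℕₚ.+-comm j 2) (sums S₀ r s n)
      (skip (skip (middle j (2 ℕ.+ q) n n≤ (_ , refl ∷ refl ∷ [] , refl , refl))))
    where
    e : ∀ j q → j ℕ.+ (2 ℕ.+ q) ≡ 2 ℕ.+ j ℕ.+ q
    e = ℕSolver.solve-∀
    sums : ∀ S₀ r s n → S₀ ℕ.+ n ℕ.+ (r ℕ.+ (s ℕ.+ 0)) ≡ S₀ ℕ.+ (r ℕ.+ s ℕ.+ n)
    sums = ℕSolver.solve-∀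

  -- All five segments contain the summand `S₀`; measuring from it keeps `S` out of the conditions
  -- under which they join.
  Hit : ℕ → Set
  Hit y = Sums (2 ℕ.+ j) A (+ (S₀ ℕ.+ y))

  -- Extends a run of sums past its end by a segment that starts at the latest right after it.
  extend : ∀ {lo end lo′ len} → (∀ y → lo ℕ.≤ y → y ℕ.≤ end → Hit y) →
           (∀ n → n ℕ.≤ len → Hit (lo′ ℕ.+ n)) → lo′ ℕ.≤ suc end →
           ∀ y → lo ℕ.≤ y → y ℕ.≤ lo′ ℕ.+ len → Hit y
  extend {end = end} {lo′} run segment lo′≤ y lo≤y y≤ with y ℕ.≤? end
  ... | yes y≤end = run y lo≤y y≤end
  ... | no  y≰end = subst Hit eq (segment (y ℕ.∸ lo′)
                      (ℕₚ.≤-trans (ℕₚ.∸-monoˡ-≤ lo′ y≤) (ℕₚ.≤-reflexive (ℕₚ.m+n∸m≡n lo′ _))))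
    where
    eq : lo′ ℕ.+ (y ℕ.∸ lo′) ≡ y
    eq = ℕₚ.m+[n∸m]≡n (ℕₚ.≤-trans lo′≤ (ℕₚ.≰⇒> y≰end))

  -- Consecutive segments leave no hole because the end gaps are small: the four junction conditions
  -- follow from `β ≤ suc j`, `μ ≤ q`, `δ + γ ≤ q` and `γ ≤ suc j`.
  all-sums : β ℕ.≤ 3 → μ ℕ.≤ 6 → δ ℕ.+ γ ℕ.≤ 6 → γ ℕ.≤ 3 → 2 ℕ.≤ j → 6 ℕ.≤ q →
             ∀ y → α ℕ.≤ y → y ℕ.≤ top → Hit y
  all-sums β≤3 μ≤6 δγ≤6 γ≤3 2≤j 6≤q = run₅
    where
    run₁ : ∀ y → α ℕ.≤ y → y ℕ.≤ α ℕ.+ j ℕ.* (2 ℕ.+ q) → Hit y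
    run₁ y α≤y y≤ = subst Hit (ℕₚ.m+[n∸m]≡n α≤y) (segment₁ (y ℕ.∸ α)
                      (ℕₚ.≤-trans (ℕₚ.∸-monoˡ-≤ α y≤) (ℕₚ.≤-reflexive (ℕₚ.m+n∸m≡n α _))))
    -- Here `z` is the part common to both sides of a junction condition, and `w` is the slack that
    -- remains.
    bound : ∀ {x y x′ y′ z} → x ℕ.≤ y → x ℕ.+ z ≡ x′ → ∀ w → y ℕ.+ z ℕ.+ w ≡ y′ → x′ ℕ.≤ y′
    bound {z = z} x≤y refl w refl = ℕₚ.≤-trans (ℕₚ.+-monoˡ-≤ z x≤y) (ℕₚ.m≤m+n _ w)
    run₂ = extend run₁ segment₂
      (bound {z = α ℕ.+ j} (ℕₚ.≤-trans β≤3 (ℕ.s≤s 2≤j)) (lhs α β j) (j ℕ.* q) (rhs α j q))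
      where
      lhs : ∀ α β j → β ℕ.+ (α ℕ.+ j) ≡ β ℕ.+ α ℕ.+ j
      lhs = ℕSolver.solve-∀
      rhs : ∀ α j q → suc j ℕ.+ (α ℕ.+ j) ℕ.+ j ℕ.* q ≡ suc (α ℕ.+ j ℕ.* (2 ℕ.+ q))
      rhs = ℕSolver.solve-∀
    run₃ = extend run₂ segment₃
      (bound {z = μ ℕ.+ j ℕ.+ suc j} (ℕₚ.≤-trans μ≤6 6≤q) (lhs μ j) (suc (j ℕ.* q)) (rhs μ j q))
      where
      lhs : ∀ μ j → μ ℕ.+ (μ ℕ.+ j ℕ.+ suc j) ≡ μ ℕ.+ j ℕ.+ (μ ℕ.+ suc j)
      lhs = ℕSolver.solve-∀
      rhs : ∀ μ j q → q ℕ.+ (μ ℕ.+ j ℕ.+ suc j) ℕ.+ suc (j ℕ.* q) ≡ suc (μ ℕ.+ j ℕ.+ suc j ℕ.* suc q)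
      rhs = ℕSolver.solve-∀
    run₄ = extend run₃ segment₄
      (bound {z = suc j ℕ.+ q ℕ.+ μ ℕ.+ (μ ℕ.+ j)} (ℕₚ.≤-trans δγ≤6 6≤q) (lhs δ γ μ j q)
        (suc (j ℕ.* q)) (rhs μ j q))
      where
      lhs : ∀ δ γ μ j q → δ ℕ.+ γ ℕ.+ (suc j ℕ.+ q ℕ.+ μ ℕ.+ (μ ℕ.+ j)) ≡
                          δ ℕ.+ (γ ℕ.+ (suc j ℕ.+ q ℕ.+ μ)) ℕ.+ (μ ℕ.+ j)
      lhs = ℕSolver.solve-∀
      rhs : ∀ μ j q → q ℕ.+ (suc j ℕ.+ q ℕ.+ μ ℕ.+ (μ ℕ.+ j)) ℕ.+ suc (j ℕ.* q) ≡
                      suc (μ ℕ.+ j ℕ.+ (μ ℕ.+ suc j) ℕ.+ (2 ℕ.+ j) ℕ.* q)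
      rhs = ℕSolver.solve-∀
    run₅ = extend run₄ segment₅
      (bound {z = suc j ℕ.+ q ℕ.+ μ ℕ.+ s} (ℕₚ.≤-trans γ≤3 (ℕ.s≤s 2≤j)) (lhs γ s μ j q)
        (j ℕ.* q) (rhs s μ j q))
      where
      lhs : ∀ γ s μ j q → γ ℕ.+ (suc j ℕ.+ q ℕ.+ μ ℕ.+ s) ≡ γ ℕ.+ (suc j ℕ.+ q ℕ.+ μ) ℕ.+ s
      lhs = ℕSolver.solve-∀
      rhs : ∀ s μ j q → suc j ℕ.+ (suc j ℕ.+ q ℕ.+ μ ℕ.+ s) ℕ.+ j ℕ.* q ≡
                        suc (s ℕ.+ (μ ℕ.+ j) ℕ.+ suc j ℕ.* suc q)
      rhs = ℕSolver.solve-∀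

  length-A : length A ≡ 2 ℕ.+ j ℕ.+ (4 ℕ.+ q)
  length-A = trans (cong (λ l → 2 ℕ.+ l) (Listₚ.length-++ (ap (+ μ) (+ 1) (2 ℕ.+ j ℕ.+ q))))
    (trans (cong (λ l → 2 ℕ.+ (l ℕ.+ 2)) (length-ap (+ μ) (+ 1) (2 ℕ.+ j ℕ.+ q))) (lemma j q))
    where
    lemma : ∀ j q → 2 ℕ.+ (2 ℕ.+ j ℕ.+ q ℕ.+ 2) ≡ 2 ℕ.+ j ℕ.+ (4 ℕ.+ q)
    lemma = ℕSolver.solve-∀

  take-A : ∀ a b → a ℕ.+ b ≡ 2 ℕ.+ j ℕ.+ q → sumℤ (take (2 ℕ.+ a) A) ≡ + (α ℕ.+ S μ a)
  take-A a b eq = trans (ℤₚ.+-identityˡ _) (cong (ℤ._+_ (+ α)) (trans (prefix eq) (sum-ap μ a)))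
    where
    prefix : ∀ {l X} → a ℕ.+ b ≡ l → sumℤ (take a (ap (+ μ) (+ 1) l ++ X)) ≡ sumℤ (ap (+ μ) (+ 1) a)
    prefix {X = X} refl = cong sumℤ (take-ap a b X)

  sum-A : sumℤ A ≡ + (α ℕ.+ (S μ (2 ℕ.+ j ℕ.+ q) ℕ.+ (r ℕ.+ (s ℕ.+ 0))))
  sum-A = trans (ℤₚ.+-identityˡ _) (cong (ℤ._+_ (+ α))
    (trans (sum-++ (ap (+ μ) (+ 1) (2 ℕ.+ j ℕ.+ q)) _)
      (cong (λ x → x + + (r ℕ.+ (s ℕ.+ 0))) (sum-ap μ (2 ℕ.+ j ℕ.+ q)))))

  S-++ : ∀ m a b → S m (a ℕ.+ b) ≡ S m a ℕ.+ S (a ℕ.+ m) b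
  S-++ m zero    b = refl
  S-++ m (suc a) b = trans (cong (m ℕ.+_) (S-++ (suc m) a b))
    (trans (sym (ℕₚ.+-assoc m _ _)) (cong (λ x → m ℕ.+ S (suc m) a ℕ.+ S x b) (ℕₚ.+-suc a m)))

  bounded-sums : Sorted A → ∀ {x} → Sums (2 ℕ.+ j) A x →
                 Σ ℕ λ y → x ≡ + (S₀ ℕ.+ y) × α ℕ.≤ y × y ℕ.≤ top
  bounded-sums sA x∈ with subst (_≤ _) (take-A j (2 ℕ.+ q) (e j q)) (Sums-lower sA x∈)
    where
    e : ∀ j q → j ℕ.+ (2 ℕ.+ q) ≡ 2 ℕ.+ j ℕ.+ q
    e = ℕSolver.solve-∀
  bounded-sums sA {+ x} x∈ | ℤ.+≤+ lower =
    x ℕ.∸ S₀ , cong +_ (sym y≡) , ℕₚ.+-cancelˡ-≤ S₀ _ _ (subst₂ ℕ._≤_ (ℕₚ.+-comm α S₀) (sym y≡) lower)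
      , ℕₚ.+-cancelˡ-≤ S₀ _ _ (subst (ℕ._≤ S₀ ℕ.+ top) (sym y≡) upper)
    where
    y≡ : S₀ ℕ.+ (x ℕ.∸ S₀) ≡ x
    y≡ = ℕₚ.m+[n∸m]≡n (ℕₚ.≤-trans (ℕₚ.m≤n+m S₀ α) lower)
    e : ∀ j q → 2 ℕ.+ q ℕ.+ j ≡ 2 ℕ.+ j ℕ.+ q
    e = ℕSolver.solve-∀
    S₁ = S μ (2 ℕ.+ q)
    S≡ : S μ (2 ℕ.+ j ℕ.+ q) ≡ S₁ ℕ.+ (S₀ ℕ.+ j ℕ.* (2 ℕ.+ q))
    S≡ = trans (cong (S μ) (sym (e j q)))
           (trans (S-++ μ (2 ℕ.+ q) j) (cong (S₁ ℕ.+_) (S-shift μ (2 ℕ.+ q) j)))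
    upper′ : + (α ℕ.+ S₁ ℕ.+ x) ≤ + (α ℕ.+ (S μ (2 ℕ.+ j ℕ.+ q) ℕ.+ (r ℕ.+ (s ℕ.+ 0))))
    upper′ = subst₂ _≤_ (cong (_+ + x) (take-A (2 ℕ.+ q) j (e j q))) sum-A
               (Sums-upper length-A sA x∈)
    upper : x ℕ.≤ S₀ ℕ.+ top
    upper = ℕₚ.+-cancelˡ-≤ (α ℕ.+ S₁) x _ (subst (α ℕ.+ S₁ ℕ.+ x ℕ.≤_)
      (trans (cong (λ z → α ℕ.+ (z ℕ.+ (r ℕ.+ (s ℕ.+ 0)))) S≡)
             (lemma α S₁ S₀ (j ℕ.* (2 ℕ.+ q)) r s))
      (ℤₚ.drop‿+≤+ upper′))
      where
      lemma : ∀ α S₁ S₀ x r s → α ℕ.+ (S₁ ℕ.+ (S₀ ℕ.+ x) ℕ.+ (r ℕ.+ (s ℕ.+ 0))) ≡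
                               α ℕ.+ S₁ ℕ.+ (S₀ ℕ.+ (r ℕ.+ s ℕ.+ x))
      lemma = ℕSolver.solve-∀

-- Counting and conclusion

Unique-length-≤ : ∀ {xs ys : List ℤ} → Unique xs → (∀ {x} → x ∈ xs → x ∈ ys) →
                  length xs ℕ.≤ length ys
Unique-length-≤ {[]}     _        _     = ℕ.z≤n
Unique-length-≤ {x ∷ xs} (p ∷ ps) xs⊆ys with ∈-∃++ (xs⊆ys (here refl))
... | l , r , refl = subst (suc (length xs) ℕ.≤_) (sym len)
                       (ℕ.s≤s (Unique-length-≤ ps λ y∈ → drop (All.lookup p y∈) (xs⊆ys (there y∈))))
  where
  len : length (l ++ x ∷ r) ≡ suc (length (l ++ r))
  len = trans (Listₚ.length-++ l)
          (trans (ℕₚ.+-suc (length l) (length r)) (cong suc (sym (Listₚ.length-++ l))))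
  drop : ∀ {y} → x ≢ y → y ∈ l ++ x ∷ r → y ∈ l ++ r
  drop x≢y y∈ with ∈-++⁻ l y∈
  ... | inj₁ q         = ∈-++⁺ˡ q
  ... | inj₂ (here e)  = ⊥-elim (x≢y (sym e))
  ... | inj₂ (there q) = ∈-++⁺ʳ l q

Sorted⇒Unique : ∀ {A} → Sorted A → Unique A
Sorted⇒Unique = AllPairs.map ℤₚ.<⇒≢

Chain⇒list : ∀ {P n s t} → Chain P n s t →
             Σ (List ℤ) λ L → Sorted L × length L ≡ n × All (s ≤_) L × All P L
Chain⇒list (stop _) = [] , [] , refl , [] , []
Chain⇒list (step s≤x p x<y c) with Chain⇒list c
... | L , sL , refl , y≤L , pL =
  _ ∷ L , All.map (ℤₚ.<-≤-trans x<y) y≤L ∷ sL , refl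
        , s≤x ∷ All.map (λ y≤ → ℤₚ.≤-trans s≤x (ℤₚ.<⇒≤ (ℤₚ.<-≤-trans x<y y≤))) y≤L , p ∷ pL

Chain-length-≤ : ∀ {P N n s t} → HasCard P N → Chain P n s t → n ℕ.≤ N
Chain-length-≤ (M , uM , refl , M⇔P) c with Chain⇒list c
... | L , sL , refl , _ , pL =
  Unique-length-≤ (Sorted⇒Unique sL) λ x∈ → Equivalence.from (M⇔P _) (All.lookup pL x∈)

HasCard-length : ∀ {P N} L → Unique L → (∀ x → (x ∈ L) ⇔ P x) → HasCard P N → N ≡ length L
HasCard-length L uL L⇔P (M , uM , refl , M⇔P) = ℕₚ.≤-antisym
  (Unique-length-≤ uM λ x∈ → Equivalence.from (L⇔P _) (Equivalence.to (M⇔P _) x∈))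
  (Unique-length-≤ uL λ x∈ → Equivalence.from (M⇔P _) (Equivalence.to (L⇔P _) x∈))

-- Invariance under permutation and passage to the sorted list

⊆-↭ : ∀ {A A′ B : List ℤ} → A ↭ A′ → B ⊆ A → Σ (List ℤ) λ B′ → B ↭ B′ × B′ ⊆ A′
⊆-↭ Perm.refl B⊆A         = _ , Perm.refl , B⊆A
⊆-↭ (Perm.prep x p)  (_ ∷ʳ B⊆A)  with ⊆-↭ p B⊆A
... | B′ , q , B′⊆ = B′ , q , x ∷ʳ B′⊆
⊆-↭ (Perm.prep x p)  (refl ∷ B⊆A) with ⊆-↭ p B⊆A
... | B′ , q , B′⊆ = x ∷ B′ , Perm.prep x q , refl ∷ B′⊆
⊆-↭ (Perm.swap x y p) (_ ∷ʳ _ ∷ʳ B⊆A) with ⊆-↭ p B⊆A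
... | B′ , q , B′⊆ = B′ , q , y ∷ʳ x ∷ʳ B′⊆
⊆-↭ (Perm.swap x y p) (_ ∷ʳ refl ∷ B⊆A) with ⊆-↭ p B⊆A
... | B′ , q , B′⊆ = y ∷ B′ , Perm.prep y q , refl ∷ x ∷ʳ B′⊆
⊆-↭ (Perm.swap x y p) (refl ∷ _ ∷ʳ B⊆A) with ⊆-↭ p B⊆A
... | B′ , q , B′⊆ = x ∷ B′ , Perm.prep x q , y ∷ʳ refl ∷ B′⊆
⊆-↭ (Perm.swap x y p) (refl ∷ refl ∷ B⊆A) with ⊆-↭ p B⊆A
... | B′ , q , B′⊆ = y ∷ x ∷ B′ , Perm.swap x y q , refl ∷ refl ∷ B′⊆
⊆-↭ (Perm.trans p₁ p₂) B⊆A with ⊆-↭ p₁ B⊆A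
... | B₁ , q₁ , B₁⊆ with ⊆-↭ p₂ B₁⊆
... | B₂ , q₂ , B₂⊆ = B₂ , Perm.trans q₁ q₂ , B₂⊆

sum-↭ : ∀ {A B} → A ↭ B → sumℤ A ≡ sumℤ B
sum-↭ Perm.refl         = refl
sum-↭ (Perm.prep x p)   = cong (ℤ._+_ x) (sum-↭ p)
sum-↭ (Perm.swap {xs} {ys} x y p) = trans (lemma x y (sumℤ xs)) (cong (λ s → y + (x + s)) (sum-↭ p))
  where
  lemma : ∀ x y s → x + (y + s) ≡ y + (x + s)
  lemma = solve-∀
sum-↭ (Perm.trans p q)  = trans (sum-↭ p) (sum-↭ q)

Sums-↭ : ∀ {h A A′ s} → A ↭ A′ → Sums h A s → Sums h A′ s
Sums-↭ p (B , B⊆A , refl , refl) with ⊆-↭ p B⊆A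
... | B′ , q , B′⊆ = B′ , B′⊆ , sym (Permₚ.↭-length q) , sym (sum-↭ q)

HasCard-↭ : ∀ {h A A′ N} → A ↭ A′ → HasCard (Sums h A) N → HasCard (Sums h A′) N
HasCard-↭ p (L , uL , len , L⇔) = L , uL , len , λ x →
  mk⇔ (λ x∈ → Sums-↭ p (Equivalence.to (L⇔ x) x∈))
      (λ x∈ → Equivalence.from (L⇔ x) (Sums-↭ (↭-sym p) x∈))

sort-Sorted : ∀ A → Unique A → Sorted (sort A)
sort-Sorted A uA = AllPairs.zipWith (λ (x≤y , x≢y) → ℤₚ.≤∧≢⇒< x≤y x≢y)
  ( Linked⇒AllPairs ℤₚ.≤-trans (sort-↗ A)
  , PermSetoidₚ.Unique-resp-↭ (setoid ℤ) (↭⇒↭ₛ (↭-sym (sort-↭ A))) uA )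

-- Intervals with two points removed

ap-∈⁺ : ∀ {m l n} → m ℕ.≤ n → n ℕ.< m ℕ.+ l → + n ∈ ap (+ m) (+ 1) l
ap-∈⁺ {m} {zero}  m≤n n<m = ⊥-elim (ℕₚ.<⇒≱ n<m (subst (ℕ._≤ _) (sym (ℕₚ.+-identityʳ m)) m≤n))
ap-∈⁺ {m} {suc l} {n} m≤n n< with ℕₚ.m≤n⇒m<n∨m≡n m≤n
... | inj₂ refl = here refl
... | inj₁ m<n  = there (ap-∈⁺ m<n (subst (n ℕ.<_) (ℕₚ.+-suc m l) n<))

ap-∈⁻ : ∀ {m l z} → z ∈ ap (+ m) (+ 1) l → Σ ℕ λ n → z ≡ + n × m ℕ.≤ n × n ℕ.< m ℕ.+ l
ap-∈⁻ {m} {suc l} (here refl) = m , refl , ℕₚ.≤-refl , ℕₚ.m<m+n m (ℕ.s≤s ℕ.z≤n)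
ap-∈⁻ {m} {suc l} (there z∈) with ap-∈⁻ z∈
... | n , refl , m<n , n< = n , refl , ℕₚ.<⇒≤ m<n , subst (n ℕ.<_) (sym (ℕₚ.+-suc m l)) n<

Sorted-ap : ∀ m l → Sorted (ap (+ m) (+ 1) l)
Sorted-ap m zero    = []
Sorted-ap m (suc l) = All.tabulate below ∷ Sorted-ap (suc m) l
  where
  below : ∀ {x} → x ∈ ap (+ suc m) (+ 1) l → + m < x
  below x∈ with ap-∈⁻ x∈
  ... | n , refl , m<n , _ = ℤ.+<+ m<n

-- [0, x + d + w + 1] without x and x + d + 1
punctured : ℕ → ℕ → ℕ → List ℤ
punctured x d w = ap (+ 0) (+ 1) x ++ ap (+ suc x) (+ 1) d ++ ap (+ suc (suc (x ℕ.+ d))) (+ 1) w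

punctured-∈ : ∀ x d w a → (a ∈ punctured x d w) ⇔
              ((+ 0 ≤ a) × (a ≤ + (suc (x ℕ.+ d) ℕ.+ w)) × ¬ (a ≡ + x) × ¬ (a ≡ + suc (x ℕ.+ d)))
punctured-∈ x d w a = mk⇔ to from
  where
  y = suc (x ℕ.+ d)
  build : ∀ {n} → n ℕ.≤ y ℕ.+ w → n ≢ x → n ≢ y →
          (+ 0 ≤ + n) × (+ n ≤ + (y ℕ.+ w)) × ¬ (+ n ≡ + x) × ¬ (+ n ≡ + y)
  build n≤ n≢x n≢y = ℤ.+≤+ ℕ.z≤n , ℤ.+≤+ n≤ , (λ e → n≢x (ℤₚ.+-injective e)) , λ e → n≢y (ℤₚ.+-injective e)
  x<y : x ℕ.< y
  x<y = ℕ.s≤s (ℕₚ.m≤m+n x d)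
  to : a ∈ punctured x d w → (+ 0 ≤ a) × (a ≤ + (y ℕ.+ w)) × ¬ (a ≡ + x) × ¬ (a ≡ + y)
  to a∈ with ∈-++⁻ (ap (+ 0) (+ 1) x) a∈
  ... | inj₁ q with ap-∈⁻ q
  ... | n , refl , _ , n<x = build (ℕₚ.≤-trans (ℕₚ.<⇒≤ (ℕₚ.<-trans n<x x<y)) (ℕₚ.m≤m+n y w))
                               (ℕₚ.<⇒≢ n<x) (ℕₚ.<⇒≢ (ℕₚ.<-trans n<x x<y))
  to a∈ | inj₂ q′ with ∈-++⁻ (ap (+ suc x) (+ 1) d) q′
  to a∈ | inj₂ q′ | inj₁ q with ap-∈⁻ q
  ... | n , refl , x<n , n<y = build (ℕₚ.≤-trans (ℕₚ.<⇒≤ n<y) (ℕₚ.m≤m+n y w))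
                                 (ℕₚ.>⇒≢ x<n) (ℕₚ.<⇒≢ n<y)
  to a∈ | inj₂ q′ | inj₂ q with ap-∈⁻ q
  ... | n , refl , y<n , n< = build (ℕₚ.≤-pred n<) (ℕₚ.>⇒≢ (ℕₚ.<-trans x<y y<n)) (ℕₚ.>⇒≢ y<n)
  from : (+ 0 ≤ a) × (a ≤ + (y ℕ.+ w)) × ¬ (a ≡ + x) × ¬ (a ≡ + y) → a ∈ punctured x d w
  from (ℤ.+≤+ {n = n} _ , ℤ.+≤+ n≤ , n≢x , n≢y) with ℕₚ.<-cmp n x | ℕₚ.<-cmp n y
  ... | tri≈ _ refl _ | _             = ⊥-elim (n≢x refl)
  ... | _             | tri≈ _ refl _ = ⊥-elim (n≢y refl)
  ... | tri< n<x _ _  | _             = ∈-++⁺ˡ (ap-∈⁺ ℕ.z≤n n<x)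
  ... | tri> _ _ x<n  | tri< n<y _ _  =
    ∈-++⁺ʳ (ap (+ 0) (+ 1) x) (∈-++⁺ˡ (ap-∈⁺ x<n n<y))
  ... | _             | tri> _ _ y<n  =
    ∈-++⁺ʳ (ap (+ 0) (+ 1) x) (∈-++⁺ʳ (ap (+ suc x) (+ 1) d) (ap-∈⁺ y<n (ℕ.s≤s n≤)))

Exceptional : ℕ → ℤ → ℤ → Set
Exceptional k x y =
  ((x ≡ + 1) × (y ≡ + 2))
  ⊎ ((x ≡ + k - + 1) × (y ≡ + k))
  ⊎ ((x ≡ + 1) × (y ≡ + k))
  ⊎ ((x ≡ + 2) × (y ≡ + (k ℕ.+ 1)))
  ⊎ ((x ≡ + k - + 2) × (y ≡ + (k ℕ.+ 1)))

Conclusion : ℕ → List ℤ → Set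
Conclusion k A = Σ ℤ λ x → Σ ℤ λ y → Exceptional k x y ×
  (∀ a → (a ∈ A) ⇔ ((+ 0 ≤ a) × (a ≤ + (k ℕ.+ 1)) × ¬ (a ≡ x) × ¬ (a ≡ y)))

punctured⇒Conclusion : ∀ {k A} x d w → A ≡ punctured x d w → suc (x ℕ.+ d) ℕ.+ w ≡ k ℕ.+ 1 →
                       Exceptional k (+ x) (+ suc (x ℕ.+ d)) → Conclusion k A
punctured⇒Conclusion {k} x d w refl eq exc = _ , _ , exc , λ a →
  subst (λ n → (a ∈ punctured x d w) ⇔ ((+ 0 ≤ a) × (a ≤ + n) × ¬ (a ≡ + x) × ¬ (a ≡ + suc (x ℕ.+ d))))
    eq (punctured-∈ x d w a)

ap-∷ʳ : ∀ m l X → ap (+ m) (+ 1) l ++ + (l ℕ.+ m) ∷ X ≡ ap (+ m) (+ 1) (suc l) ++ X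
ap-∷ʳ m zero    X = refl
ap-∷ʳ m (suc l) X = cong (+ m ∷_)
  (trans (cong (λ n → ap (+ suc m) (+ 1) l ++ + n ∷ X) (sym (ℕₚ.+-suc l m))) (ap-∷ʳ (suc m) l X))

-- If `b` or `c` is 1, the only hole is 2 or `k - 2` and the maximum is `k`, so the second excluded
-- point is `k + 1`. Otherwise `a + d` is 2, the maximum is `k + 1`, and the two holes are next to
-- the ends. With `b` and `c` in front the sum reduces far enough for the absurd patterns.
model⇒Conclusion : ∀ t a b c d → b ℕ.* 2 ℕ.+ (c ℕ.* 2 ℕ.+ (a ℕ.+ d)) ≡ 2 →
                   Conclusion (6 ℕ.+ t) (model (suc a) (suc b) (suc c) (suc d) (suc t))
model⇒Conclusion t a (suc (suc b)) c d ()
model⇒Conclusion t a 1 (suc c) d ()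
model⇒Conclusion t (suc a) 1 0 d ()
model⇒Conclusion t 0 1 0 (suc d) ()
model⇒Conclusion t 0 1 0 0 refl =
  punctured⇒Conclusion 2 (4 ℕ.+ t) 0
    (cong (λ xs → + 0 ∷ + 1 ∷ xs) (trans (ap-∷ʳ 3 (2 ℕ.+ t) _) (ap-∷ʳ 3 (3 ℕ.+ t) _)))
    (lemma t) (inj₂ (inj₂ (inj₂ (inj₁ (refl , cong +_ (lemma′ t))))))
  where
  lemma : ∀ t → suc (2 ℕ.+ (4 ℕ.+ t)) ℕ.+ 0 ≡ 6 ℕ.+ t ℕ.+ 1
  lemma = ℕSolver.solve-∀
  lemma′ : ∀ t → suc (2 ℕ.+ (4 ℕ.+ t)) ≡ 6 ℕ.+ t ℕ.+ 1
  lemma′ = ℕSolver.solve-∀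
model⇒Conclusion t a 0 (suc (suc c)) d ()
model⇒Conclusion t (suc a) 0 1 d ()
model⇒Conclusion t 0 0 1 (suc d) ()
model⇒Conclusion t 0 0 1 0 refl =
  punctured⇒Conclusion (4 ℕ.+ t) 2 0
    (cong (λ n → + 0 ∷ + 1 ∷ ap (+ 2) (+ 1) (2 ℕ.+ t) ++ + (3 ℕ.+ n) ∷ + (4 ℕ.+ n) ∷ [])
      (ℕₚ.+-comm t 2))
    (lemma t) (inj₂ (inj₂ (inj₂ (inj₂ (refl , cong +_ (lemma′ t))))))
  where
  lemma : ∀ t → suc (4 ℕ.+ t ℕ.+ 2) ℕ.+ 0 ≡ 6 ℕ.+ t ℕ.+ 1
  lemma = ℕSolver.solve-∀
  lemma′ : ∀ t → suc (4 ℕ.+ t ℕ.+ 2) ≡ 6 ℕ.+ t ℕ.+ 1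
  lemma′ = ℕSolver.solve-∀
model⇒Conclusion t 0 0 0 2 refl =
  punctured⇒Conclusion (5 ℕ.+ t) 0 1
    (trans (cong (λ xs → + 0 ∷ + 1 ∷ xs) (ap-∷ʳ 2 (2 ℕ.+ t) _))
      (cong (λ n → ap (+ 0) (+ 1) (5 ℕ.+ t) ++ + n ∷ []) (lemma t)))
    (lemma₁ t) (inj₂ (inj₁ (refl , cong +_ (lemma₂ t))))
  where
  lemma : ∀ t → 5 ℕ.+ (t ℕ.+ 2) ≡ suc (suc (5 ℕ.+ t ℕ.+ 0))
  lemma = ℕSolver.solve-∀
  lemma₁ : ∀ t → suc (5 ℕ.+ t ℕ.+ 0) ℕ.+ 1 ≡ 6 ℕ.+ t ℕ.+ 1
  lemma₁ = ℕSolver.solve-∀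
  lemma₂ : ∀ t → suc (5 ℕ.+ t ℕ.+ 0) ≡ 6 ℕ.+ t
  lemma₂ = ℕSolver.solve-∀
model⇒Conclusion t 1 0 0 1 refl =
  punctured⇒Conclusion 1 (4 ℕ.+ t) 1
    (trans (cong (λ xs → + 0 ∷ + 2 ∷ xs) (ap-∷ʳ 3 (2 ℕ.+ t) _))
      (cong (λ n → + 0 ∷ ap (+ 2) (+ 1) (4 ℕ.+ t) ++ + n ∷ []) (lemma t)))
    (lemma₁ t) (inj₂ (inj₂ (inj₁ (refl , refl))))
  where
  lemma : ∀ t → 4 ℕ.+ (t ℕ.+ 3) ≡ suc (suc (1 ℕ.+ (4 ℕ.+ t)))
  lemma = ℕSolver.solve-∀
  lemma₁ : ∀ t → suc (1 ℕ.+ (4 ℕ.+ t)) ℕ.+ 1 ≡ 6 ℕ.+ t ℕ.+ 1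
  lemma₁ = ℕSolver.solve-∀
model⇒Conclusion t 2 0 0 0 refl =
  punctured⇒Conclusion 1 0 (5 ℕ.+ t)
    (cong (λ xs → + 0 ∷ + 3 ∷ xs)
      (trans (ap-∷ʳ 4 (2 ℕ.+ t) _) (trans (ap-∷ʳ 4 (3 ℕ.+ t) []) (Listₚ.++-identityʳ _))))
    (lemma t) (inj₁ (refl , refl))
  where
  lemma : ∀ t → 2 ℕ.+ (5 ℕ.+ t) ≡ 6 ℕ.+ t ℕ.+ 1
  lemma = ℕSolver.solve-∀

Small-pred : ∀ {α} → Small α → Σ ℕ λ a → α ≡ suc a × a ℕ.≤ 2
Small-pred (inj₁ refl)        = 0 , refl , ℕ.z≤n
Small-pred (inj₂ (inj₁ refl)) = 1 , refl , ℕ.s≤s ℕ.z≤n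
Small-pred (inj₂ (inj₂ refl)) = 2 , refl , ℕₚ.≤-refl

model-cardinality : ∀ {a b c d} j q → let A = model (suc a) (suc b) (suc c) (suc d) (suc j ℕ.+ q) in
                    a ℕ.≤ 2 → b ℕ.≤ 2 → c ℕ.≤ 2 → d ℕ.≤ 2 → 2 ℕ.≤ j → 6 ℕ.≤ q → Sorted A →
                    HasCard (Sums (2 ℕ.+ j) A) ((2 ℕ.+ j) ℕ.* (4 ℕ.+ q) ℕ.+ 3) →
                    b ℕ.* 2 ℕ.+ (c ℕ.* 2 ℕ.+ (a ℕ.+ d)) ≡ 2
model-cardinality {a} {b} {c} {d} j q a≤2 b≤2 c≤2 d≤2 2≤j 6≤q sA card =
  sym (ℕₚ.+-cancelˡ-≡ (9 ℕ.+ 4 ℕ.* j ℕ.+ 2 ℕ.* q ℕ.+ j ℕ.* q) 2 _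
    (trans (lhs j q) (trans (HasCard-length M (Sorted⇒Unique (Sorted-ap _ N)) M⇔ card)
      (trans (length-ap (+ (S₀ ℕ.+ suc a)) (+ 1) N) (rhs a b c d j q)))))
  where
  open Model {suc a} {suc b} {suc c} {suc d} j q
  -- This is `suc top` less `suc a`: one occurrence of `μ` is replaced by `suc b`, which avoids
  -- truncated subtraction.
  N = suc (suc c ℕ.+ (suc j ℕ.+ q ℕ.+ suc b) ℕ.+ s ℕ.+ j ℕ.* (2 ℕ.+ q))
  M = ap (+ (S₀ ℕ.+ suc a)) (+ 1) N
  lhs : ∀ j q → 9 ℕ.+ 4 ℕ.* j ℕ.+ 2 ℕ.* q ℕ.+ j ℕ.* q ℕ.+ 2 ≡ (2 ℕ.+ j) ℕ.* (4 ℕ.+ q) ℕ.+ 3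
  lhs = ℕSolver.solve-∀
  rhs : ∀ a b c d j q →
        suc (suc c ℕ.+ (suc j ℕ.+ q ℕ.+ suc b) ℕ.+
             (suc d ℕ.+ (suc c ℕ.+ (suc j ℕ.+ q ℕ.+ (suc b ℕ.+ suc a)))) ℕ.+ j ℕ.* (2 ℕ.+ q)) ≡
        9 ℕ.+ 4 ℕ.* j ℕ.+ 2 ℕ.* q ℕ.+ j ℕ.* q ℕ.+ (b ℕ.* 2 ℕ.+ (c ℕ.* 2 ℕ.+ (a ℕ.+ d)))
  rhs = ℕSolver.solve-∀
  N≡ : S₀ ℕ.+ suc a ℕ.+ N ≡ suc (S₀ ℕ.+ top)
  N≡ = lemma S₀ (suc a) (suc c) (suc j ℕ.+ q) (suc b) s (j ℕ.* (2 ℕ.+ q))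
    where
    lemma : ∀ S₀ α γ l β s x → S₀ ℕ.+ α ℕ.+ suc (γ ℕ.+ (l ℕ.+ β) ℕ.+ s ℕ.+ x) ≡
                               suc (S₀ ℕ.+ (γ ℕ.+ (l ℕ.+ (β ℕ.+ α)) ℕ.+ s ℕ.+ x))
    lemma = ℕSolver.solve-∀
  M⇔ : ∀ x → (x ∈ M) ⇔ Sums (2 ℕ.+ j) A x
  M⇔ x = mk⇔ to from
    where
    to : x ∈ M → Sums (2 ℕ.+ j) A x
    to x∈ with ap-∈⁻ x∈
    ... | n , refl , lo≤n , n<hi = subst (λ n → Sums (2 ℕ.+ j) A (+ n)) n≡
        (all-sums (ℕ.s≤s b≤2) (ℕₚ.+-mono-≤ (ℕ.s≤s b≤2) (ℕ.s≤s a≤2))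
          (ℕₚ.+-mono-≤ (ℕ.s≤s d≤2) (ℕ.s≤s c≤2)) (ℕ.s≤s c≤2) 2≤j 6≤q (n ℕ.∸ S₀)
          (ℕₚ.+-cancelˡ-≤ S₀ _ _ (subst (S₀ ℕ.+ suc a ℕ.≤_) (sym n≡) lo≤n))
          (ℕₚ.+-cancelˡ-≤ S₀ _ _ (subst (ℕ._≤ S₀ ℕ.+ top) (sym n≡)
            (ℕₚ.≤-pred (subst (suc n ℕ.≤_) N≡ n<hi)))))
      where
      n≡ : S₀ ℕ.+ (n ℕ.∸ S₀) ≡ n
      n≡ = ℕₚ.m+[n∸m]≡n (ℕₚ.≤-trans (ℕₚ.m≤m+n S₀ (suc a)) lo≤n)
    from : Sums (2 ℕ.+ j) A x → x ∈ M
    from x∈ with bounded-sums sA x∈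
    ... | y , refl , α≤y , y≤top = ap-∈⁺ (ℕₚ.+-monoʳ-≤ S₀ α≤y)
                                     (subst (suc (S₀ ℕ.+ y) ℕ.≤_) (sym N≡) (ℕ.s≤s (ℕₚ.+-monoʳ-≤ S₀ y≤top)))

-- Primitivity is stated through common divisors rather than `gcdList`, since in this form it passes
-- to a permuted list directly.
sorted-case : ∀ H q A → let h = 4 ℕ.+ H ; g = 10 ℕ.+ q in
              Sorted A → length A ≡ h ℕ.+ g → + 0 ∈ A → (∀ a → a ∈ A → + 0 ≤ a) →
              (∀ c → All (c ℤDiv.∣_) A → ∣ c ∣ ≡ 1) →
              HasCard (Sums h A) (h ℕ.* g ℕ.+ 3) → Conclusion (h ℕ.+ g) A
sorted-case H q A sA len 0∈A 0≤A prim card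
  with Shape⇒model A sA 0∈A 0≤A prim
         (no-excess⇒Shape H (5 ℕ.+ q) (4 ℕ.+ H ℕ.+ q) A sA
           (trans len (cong₂ ℕ._+_ (ℕₚ.+-comm 4 H) (ℕₚ.+-comm 5 (5 ℕ.+ q))))
           (trans len (count H q)) ¬e)
  where
  count : ∀ H q → 4 ℕ.+ H ℕ.+ (10 ℕ.+ q) ≡ 10 ℕ.+ (4 ℕ.+ H ℕ.+ q)
  count = ℕSolver.solve-∀
  -- Excess 3 would mean `h g + 4` sums, one more than there are.
  ¬e : ¬ Excess 3 (H ℕ.+ 4) (5 ℕ.+ q ℕ.+ 5) A
  ¬e x with subst₂ (λ h g → Excess 3 h g A) (ℕₚ.+-comm H 4) (ℕₚ.+-comm (5 ℕ.+ q) 5) x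
  ... | _ , _ , ch = ℕₚ.<⇒≱ (ℕₚ.+-monoʳ-< ((4 ℕ.+ H) ℕ.* (10 ℕ.+ q)) {3} {4} ℕₚ.≤-refl)
                       (Chain-length-≤ card ch)
... | α , β , γ , δ , sα , sβ , sγ , sδ , A≡
  with Small-pred sα | Small-pred sβ | Small-pred sγ | Small-pred sδ
... | a , refl , a≤2 | b , refl , b≤2 | c , refl , c≤2 | d , refl , d≤2
  with trans A≡ (cong (model (suc a) (suc b) (suc c) (suc d)) (index H q))
  where
  index : ∀ H q → 4 ℕ.+ suc (4 ℕ.+ H ℕ.+ q) ≡ suc (2 ℕ.+ H) ℕ.+ (6 ℕ.+ q)
  index = ℕSolver.solve-∀
... | refl = subst (λ k → Conclusion k A) (size H q)
  (model⇒Conclusion (2 ℕ.+ H ℕ.+ (6 ℕ.+ q)) a b c d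
    (model-cardinality (2 ℕ.+ H) (6 ℕ.+ q) a≤2 b≤2 c≤2 d≤2
      (ℕ.s≤s (ℕ.s≤s ℕ.z≤n)) (ℕₚ.m≤m+n 6 q) sA card))
  where
  size : ∀ H q → 6 ℕ.+ (2 ℕ.+ H ℕ.+ (6 ℕ.+ q)) ≡ 4 ℕ.+ H ℕ.+ (10 ℕ.+ q)
  size = ℕSolver.solve-∀

theorem1p12 : (h k : ℕ) → 4 ℕ.≤ h → 3 ℕ.* h ℕ.+ 3 ℕ.≤ k →
    (A : List ℤ) → Unique A → length A ≡ k →
    MinIsZero A → gcdList A ≡ 1 →
    HasCard (λ s → s ∈RestrSumset h , A) (h ℕ.* k ℕ.∸ h ℕ.* h ℕ.+ 3) →
    Σ ℤ λ x → Σ ℤ λ y →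
    (((x ≡ + 1) × (y ≡ + 2))
    ⊎ ((x ≡ + k - + 1) × (y ≡ + k))
    ⊎ ((x ≡ + 1) × (y ≡ + k))
    ⊎ ((x ≡ + 2) × (y ≡ + (k ℕ.+ 1)))
    ⊎ ((x ≡ + k - + 2) × (y ≡ + (k ℕ.+ 1))))
    × (∀ a → (a ∈ A) ⇔ ((+ 0 ℤ.≤ a) × (a ℤ.≤ + (k ℕ.+ 1)) × ¬ (a ≡ x) × ¬ (a ≡ y)))
theorem1p12 h k 4≤h 3h+3≤k A uA len (0∈A , 0≤A) gcd≡1 card
  with ℕₚ.m≤n⇒∃[o]m+o≡n 4≤h
... | H , refl with ℕₚ.m≤n⇒∃[o]m+o≡n (ℕₚ.≤-trans h+10≤3h+3 3h+3≤k)
  where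
  -- The 10 is `4 + 6`: in `model-cardinality` the number of non-summands is `4 + q`, and `q` has to
  -- reach 6, the largest possible value of `α + β` and `γ + δ`.
  h+10≤3h+3 : 4 ℕ.+ H ℕ.+ 10 ℕ.≤ 3 ℕ.* (4 ℕ.+ H) ℕ.+ 3
  h+10≤3h+3 = subst (4 ℕ.+ H ℕ.+ 10 ℕ.≤_) (lemma H) (ℕₚ.m≤m+n _ (1 ℕ.+ 2 ℕ.* H))
    where
    lemma : ∀ H → 4 ℕ.+ H ℕ.+ 10 ℕ.+ (1 ℕ.+ 2 ℕ.* H) ≡ 3 ℕ.* (4 ℕ.+ H) ℕ.+ 3
    lemma = ℕSolver.solve-∀
... | q , refl = transfer (subst (λ k → Conclusion k (sort A)) (sym k≡)
  (sorted-case H q (sort A) (sort-Sorted A uA)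
    (trans (Permₚ.↭-length (sort-↭ A)) (trans len k≡))
    (Permₚ.∈-resp-↭ (↭-sym (sort-↭ A)) 0∈A)
    (λ a a∈ → 0≤A a (Permₚ.∈-resp-↭ (sort-↭ A) a∈))
    (λ c c∣ → ℕDiv.∣1⇒≡1 (subst (∣ c ∣ ℕDiv.∣_) gcd≡1
      (gcdList-greatest A (Permₚ.All-resp-↭ (sort-↭ A) c∣))))
    (subst (HasCard _) (cong (ℕ._+ 3) card≡) (HasCard-↭ (↭-sym (sort-↭ A)) card))))
  where
  k≡ : 4 ℕ.+ H ℕ.+ 10 ℕ.+ q ≡ 4 ℕ.+ H ℕ.+ (10 ℕ.+ q)
  k≡ = ℕₚ.+-assoc (4 ℕ.+ H) 10 q
  card≡ : (4 ℕ.+ H) ℕ.* (4 ℕ.+ H ℕ.+ 10 ℕ.+ q) ℕ.∸ (4 ℕ.+ H) ℕ.* (4 ℕ.+ H) ≡ (4 ℕ.+ H) ℕ.* (10 ℕ.+ q)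
  card≡ = trans (sym (ℕₚ.*-distribˡ-∸ (4 ℕ.+ H) (4 ℕ.+ H ℕ.+ 10 ℕ.+ q) (4 ℕ.+ H)))
            (cong ((4 ℕ.+ H) ℕ.*_) (trans (cong (ℕ._∸ (4 ℕ.+ H)) k≡) (ℕₚ.m+n∸m≡n (4 ℕ.+ H) (10 ℕ.+ q))))
  transfer : ∀ {k} → Conclusion k (sort A) → Conclusion k A
  transfer (x , y , exc , mem) = x , y , exc , λ a →
    mk⇔ (λ a∈ → Equivalence.to (mem a) (Permₚ.∈-resp-↭ (↭-sym (sort-↭ A)) a∈))
        (λ a∈ → Permₚ.∈-resp-↭ (sort-↭ A) (Equivalence.from (mem a) a∈))
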